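{- Let $T$ be an irreducible triangulation of a closed surface other than the sphere $S_0$, let $w_1w_2w_3$ be a nonseparating 3-cycle of $T$, and let $T'$ be the pre-irreducible triangulation obtained from $T$ by the cut/cap operation along $w_1w_2w_3$ (with boundary vertices $u'_1,u'_2,u'_3,v'_1,v'_2,v'_3$ as described in the context). Let $T''$ be a triangulation obtained from $T'$ by contracting zero or more interior edges. Then: (1) every edge of $T''$ is a frame edge, or is not contractible, or lies on a path of length at most 3 connecting $u'_i$ and $v'_i$ for some $i\in\{1,2,3\}$; (2) every vertex of $T''$ is a frame vertex, or lies on a noncontractible edge, or lies both on a path of length at most 3 connecting $u'_i$ and $v'_i$ and on a path of length at most 3 connecting $u'_j$ and $v'_j$ for some $1 \le i < j \le 3$.
   Context: A triangulation of a closed surface is a simple graph embedded in the surface such that each face is a triangle and any two faces share at most one edge. For an edge $ac$ with incident faces $abc$ and $acd$, the contraction of $ac$ deletes $ac$, identifies $a$ and $c$, and removes one of each pair of resulting multiple edges ($ab$/$cb$ and $ad$/$cd$). An edge is contractible if its contraction yields a triangulation of the same surface (for triangulations other than $K_4$ on the sphere, equivalently if it lies on exactly two 3-cycles, namely the two facial ones). A triangulation is irreducible if it has no contractible edges. A 3-cycle embedded as a closed curve $C$ in surface $S$ is nonseparating if $S-C$ is connected; it is one-sided if a neighbourhood of $C$ is a Möbius band, and two-sided otherwise. Cut/cap operation: if $w_1w_2w_3$ is two-sided, cut the surface along it, obtaining two boundary 3-cycles $u'_1u'_2u'_3$ and $v'_1v'_2v'_3$, where $u'_i$ and $v'_i$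 come from $w_i$; cap each hole with a new face $u'_1u'_2u'_3$, resp. $v'_1v'_2v'_3$. If $w_1w_2w_3$ is one-sided, cut along it, obtaining a boundary 6-cycle $u'_1u'_2u'_3v'_1v'_2v'_3$ (again $u'_i,v'_i$ come from $w_i$); cap the hole with a new vertex $t'$ and the six faces $t'u'_1u'_2$, $t'u'_2u'_3$, $t'u'_3v'_1$, $t'v'_1v'_2$, $t'v'_2v'_3$, $t'v'_3u'_1$. The result $T'$ is called a pre-irreducible triangulation. The frame is the subgraph consisting of the vertices and edges of the two added faces (two-sided case) or of the six added faces (one-sided case); its vertices and edges are frame vertices and frame edges. Non-frame vertices are interior vertices; an interior edge is an edge both of whose endpoints are interior vertices. Contracting interior edges leaves the frame (and the labels $u'_i,v'_i$) unchanged. -}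

module Defs where

open import Data.Nat using (ℕ; _+_; _≤_; _<_; _≡ᵇ_; _⊓_; _⊔_)
open import Data.Nat.Properties using (_≟_)
open import Data.Bool using (Bool; true; false; if_then_else_; not; _∧_; _∨_)
open import Data.Fin using (Fin) renaming (zero to f0)
import Data.Fin as Fin
open import Data.List using (List; []; _∷_; _++_; length; lookup; tabulate; map; filterᵇ; deduplicate; concatMap)
open import Data.List.Membership.Propositional using (_∈_; _∉_)
open import Data.List.Relation.Unary.Unique.Propositional using (Unique)
open import Data.Product using (_×_; _,_; ∃; ∃₂; Σ)
open import Data.Product.Properties using (≡-dec)
open import Data.Sum using (_⊎_)
open import Data.Unit using (⊤)
open import Relation.Binary.PropositionalEquality using (_≡_; _≢_)
open import Relation.Nullary using (¬_)

-- Combinatorial triangulations.  Vertices are natural numbers; a face is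
-- an (unordered, but written as a) triple of vertices; a triangulation
-- is given by its list of faces.

Face : Set
Face = ℕ × ℕ × ℕ

Complex : Set
Complex = List Face

_∈ᶠ_ : ℕ → Face → Set
x ∈ᶠ (a , b , c) = x ≡ a ⊎ x ≡ b ⊎ x ≡ c

Idx : Complex → Set
Idx F = Fin (length F)

Has : (F : Complex) → Idx F → ℕ → Set
Has F k x = x ∈ᶠ lookup F k

VertexOf : Complex → ℕ → Set
VertexOf F x = ∃ λ k → Has F k x

Adj : Complex → ℕ → ℕ → Set
Adj F x y = x ≢ y × ∃ λ k → Has F k x × Has F k y

data Reach {A : Set} (R : A → A → Set) : A → A → Set where
  here  : ∀ {x} → Reach R x x
  there : ∀ {x y z} → R x y → Reach R y z → Reach R x z

LinkEdge : Complex → ℕ → ℕ → ℕ → Set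
LinkEdge F x y z =
  x ≢ y × x ≢ z × y ≢ z × ∃ λ k → Has F k x × Has F k y × Has F k z

-- Triangulation of a closed surface: a finite connected pure 2-complex
-- in which faces are triangles with 3 distinct vertices, distinct faces
-- have distinct vertex sets (so two faces share at most one edge), every
-- edge lies on exactly two faces, and every vertex link is connected
-- (hence, being 2-regular, a single cycle).
record IsTriangulation (F : Complex) : Set where
  field
    nonempty      : 0 < length F
    faceDistinct  : ∀ k → let (a , b , c) = lookup F k in a ≢ b × b ≢ c × a ≢ c
    facesDistinct : ∀ k l → (∀ x → Has F k x → Has F l x) → k ≡ l
    edgeTwoFaces  : ∀ x y → Adj F x y →
      ∃₂ λ k l → k ≢ l × Has F k x × Has F k y × Has F l x × Has F l y ×
        (∀ m → Has F m x → Has F m y → m ≡ k ⊎ m ≡ l)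
    linkConnected : ∀ x y z → Adj F x y → Adj F x z → Reach (LinkEdge F x) y z
    connected     : ∀ x y → VertexOf F x → VertexOf F y → Reach (Adj F) x y

-- Euler characteristic data; the sphere is the closed surface with χ = 2
vertexList : Complex → List ℕ
vertexList F = deduplicate _≟_ (concatMap (λ { (a , b , c) → a ∷ b ∷ c ∷ [] }) F)

normEdge : ℕ → ℕ → ℕ × ℕ
normEdge a b = (a ⊓ b , a ⊔ b)

edgeList : Complex → List (ℕ × ℕ)
edgeList F = deduplicate (≡-dec _≟_ _≟_)
  (concatMap (λ { (a , b , c) → normEdge a b ∷ normEdge b c ∷ normEdge a c ∷ [] }) F)

IsSphere : Complex → Set
IsSphere F = length (vertexList F) + length F ≡ length (edgeList F) + 2

Contractible : Complex → ℕ → ℕ → Set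
Contractible F a c = ∃₂ λ b₁ b₂ → b₁ ≢ b₂ ×
  Adj F a b₁ × Adj F c b₁ × Adj F a b₂ × Adj F c b₂ ×
  (∀ b → Adj F a b → Adj F c b → b ≡ b₁ ⊎ b ≡ b₂)

Irreducible : Complex → Set
Irreducible F = ∀ x y → Adj F x y → ¬ Contractible F x y

InC : (Fin 3 → ℕ) → ℕ → Set
InC w x = ∃ λ i → x ≡ w i

ThreeCycle : Complex → (Fin 3 → ℕ) → Set
ThreeCycle F w = (∀ i j → w i ≡ w j → i ≡ j) × (∀ i j → i ≢ j → Adj F (w i) (w j))

FaceAdjOffC : (F : Complex) → (Fin 3 → ℕ) → Idx F → Idx F → Set
FaceAdjOffC F w k l = ∃₂ λ x y → x ≢ y ×
  Has F k x × Has F k y × Has F l x × Has F l y × ¬ (InC w x × InC w y)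

-- S - C is connected: faces can be joined through edges not on C
Nonseparating : Complex → (Fin 3 → ℕ) → Set
Nonseparating F w = ∀ k l → Reach (FaceAdjOffC F w) k l

-- Cut/cap along w.  A side assignment says, for each face k containing
-- w i, whether its corner at w i goes to the copy u i (true) or v i.

Sides : Complex → Set
Sides F = Idx F → Fin 3 → Bool

-- corners at w i are grouped by adjacency across edges w i x not on C,
-- and the two faces on an edge w i w j of C lie on opposite sides
LocalSides : (F : Complex) → (Fin 3 → ℕ) → Sides F → Set
LocalSides F w s =
  (∀ i k l x → ¬ InC w x → Has F k (w i) → Has F k x → Has F l (w i) → Has F l x →
     s k i ≡ s l i) ×
  (∀ i j → i ≢ j → ∀ k l → k ≢ l →
     Has F k (w i) → Has F k (w j) → Has F l (w i) → Has F l (w j) → s k i ≢ s l i)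

i0 i1 i2 : Fin 3
i0 = f0
i1 = Fin.suc f0
i2 = Fin.suc (Fin.suc f0)

-- two-sided: boundaries u0u1u2 and v0v1v2
TwoSidedNaming : (F : Complex) → (Fin 3 → ℕ) → Sides F → Set
TwoSidedNaming F w s = ∀ i j k → i ≢ j → Has F k (w i) → Has F k (w j) → s k i ≡ s k j

-- one-sided: boundary 6-cycle u0u1u2v0v1v2
OneSidedNaming : (F : Complex) → (Fin 3 → ℕ) → Sides F → Set
OneSidedNaming F w s =
  (∀ k → Has F k (w i0) → Has F k (w i1) → s k i0 ≡ s k i1) ×
  (∀ k → Has F k (w i1) → Has F k (w i2) → s k i1 ≡ s k i2) ×
  (∀ k → Has F k (w i2) → Has F k (w i0) → s k i2 ≢ s k i0)

renV : (w u v : Fin 3 → ℕ) → (Fin 3 → Bool) → ℕ → ℕ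
renV w u v σ x =
  if x ≡ᵇ w i0 then pick i0 else
  if x ≡ᵇ w i1 then pick i1 else
  if x ≡ᵇ w i2 then pick i2 else x
  where
  pick : Fin 3 → ℕ
  pick i = if σ i then u i else v i

renFace : (ℕ → ℕ) → Face → Face
renFace r (a , b , c) = (r a , r b , r c)

cutFaces : (F : Complex) → (w u v : Fin 3 → ℕ) → Sides F → Complex
cutFaces F w u v s = tabulate (λ k → renFace (renV w u v (s k)) (lookup F k))

capsTwo : (u v : Fin 3 → ℕ) → Complex
capsTwo u v = (u i0 , u i1 , u i2) ∷ (v i0 , v i1 , v i2) ∷ []

capsOne : (u v : Fin 3 → ℕ) → ℕ → Complex
capsOne u v t =
  (t , u i0 , u i1) ∷ (t , u i1 , u i2) ∷ (t , u i2 , v i0) ∷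
  (t , v i0 , v i1) ∷ (t , v i1 , v i2) ∷ (t , v i2 , u i0) ∷ []

Fresh : Complex → (u v : Fin 3 → ℕ) → ℕ → Set
Fresh F u v t = Unique names × (∀ x → VertexOf F x → x ∉ names)
  where
  names : List ℕ
  names = t ∷ u i0 ∷ u i1 ∷ u i2 ∷ v i0 ∷ v i1 ∷ v i2 ∷ []

-- CutCap F w u v t T' Fr : T' is the pre-irreducible triangulation and
-- Fr the list of added (frame) faces.
data CutCap (F : Complex) (w u v : Fin 3 → ℕ) (t : ℕ) : Complex → Complex → Set where
  twoSided : (s : Sides F) → LocalSides F w s → TwoSidedNaming F w s →
    CutCap F w u v t (cutFaces F w u v s ++ capsTwo u v) (capsTwo u v)
  oneSided : (s : Sides F) → LocalSides F w s → OneSidedNaming F w s →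
    CutCap F w u v t (cutFaces F w u v s ++ capsOne u v t) (capsOne u v t)

FrameVertex : Complex → ℕ → Set
FrameVertex Fr x = VertexOf Fr x

FrameEdge : Complex → ℕ → ℕ → Set
FrameEdge Fr x y = Adj Fr x y

hasᵇ : ℕ → Face → Bool
hasᵇ x (a , b , c) = (x ≡ᵇ a) ∨ (x ≡ᵇ b) ∨ (x ≡ᵇ c)

contract : Complex → ℕ → ℕ → Complex
contract F a c =
  map (renFace (λ x → if x ≡ᵇ c then a else x))
      (filterᵇ (λ f → not (hasᵇ a f ∧ hasᵇ c f)) F)

data Contracts (Fr : Complex) : Complex → Complex → Set where
  done : ∀ {F} → Contracts Fr F F
  step : ∀ {F G a c} → IsTriangulation F → Adj F a c →
    ¬ FrameVertex Fr a → ¬ FrameVertex Fr c → Contractible F a c →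
    Contracts Fr (contract F a c) G → Contracts Fr F G

ConsecAdj : Complex → List ℕ → Set
ConsecAdj G [] = ⊤
ConsecAdj G (x ∷ []) = ⊤
ConsecAdj G (x ∷ y ∷ r) = Adj G x y × ConsecAdj G (y ∷ r)

ShortPath : Complex → ℕ → ℕ → List ℕ → Set
ShortPath G a b p = ∃ λ mid → p ≡ a ∷ (mid ++ b ∷ []) × length mid ≤ 2 ×
  Unique p × ConsecAdj G p

EdgeOnShortPath : Complex → ℕ → ℕ → ℕ → ℕ → Set
EdgeOnShortPath G a b x y = ∃ λ p → ShortPath G a b p ×
  ∃₂ λ l r → (p ≡ l ++ x ∷ y ∷ r ⊎ p ≡ l ++ y ∷ x ∷ r)

VertexOnShortPath : Complex → ℕ → ℕ → ℕ → Set
VertexOnShortPath G a b x = ∃ λ p → ShortPath G a b p × x ∈ p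

{-# OPTIONS --safe #-}
-- An edge xy of the irreducible T lies on a nonfacial 3-cycle.  Cutting along C leaves this cycle
-- intact or opens it to a path of length at most 3 between two copies of a vertex of C.  Such
-- paths survive the contraction of interior edges.  A 3-cycle may become facial when the
-- last vertex inside it is contracted, but only if it bounded a disc without frame vertices.
-- Call a nonfacial 3-cycle essential if it bounds no such disc.  Discs pull back along
-- contractions, so essential 3-cycles stay essential, and edges on them are never contractible.
-- In T' every nonfacial 3-cycle xyz is essential: take a face xyp in a disc bounded by xyz;
-- the edge px lies on a nonfacial 3-cycle pxm in the closed disc, which bounds a smaller disc.
-- For vertices, such a path through an interior vertex p of T' shows that p is adjacent to a copy h
-- of some wᵢ; if n is the third vertex of a face at ph, then pn is on no short path for the same i,
-- because neither p nor n is adjacent to both copies of wᵢ.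
module Submission where

open import Defs
import Data.Nat as ℕ
open import Data.Nat using (ℕ; zero; suc; _≤_; z≤n; s≤s; _⊔_; _≡ᵇ_)
open import Data.Nat.Properties using (_≟_; n<1+n; <-irrefl; m<n⇒m<1+n; m<1+n⇒m<n∨m≡n; m≤n⇒m≤1+n; ≤-trans; <-≤-trans; m≤m⊔n; m≤n⊔m; ≡ᵇ⇒≡; ≡⇒≡ᵇ; anyUpTo?)
open import Data.Bool using (Bool; true; false; not; _∧_; _xor_; if_then_else_; T)
open import Data.Bool.Properties as Bool using (xor-same; xor-identityʳ; xor-assoc; xor-comm; ∧-comm; ∧-conicalˡ; ¬-not; not-¬; T?; not-involutive; not-distribˡ-xor)
open import Data.Product using (_×_; _,_; ∃; proj₁; proj₂; ∃₂)
open import Data.Sum as Sum using (_⊎_; inj₁; inj₂; [_,_]′)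
open import Data.Empty using (⊥; ⊥-elim)
open import Function using (_∘_)
open import Relation.Nullary using (¬_; Dec; yes; no; does; proof; ofʸ; ofⁿ; contradiction)
open import Relation.Nullary.Decidable using (dec-true; dec-false; ¬?; _×-dec_; _⊎-dec_; map′; decidable-stable)
open import Relation.Binary.PropositionalEquality
open import Data.Fin using (Fin; _↑ˡ_; _<_) renaming (zero to fzero; suc to fsuc)
import Data.Fin.Properties as Fin
open import Data.List using (List; []; _∷_; lookup; _++_)
open import Data.List.Membership.Propositional using (_∈_)
open import Data.List.Membership.Propositional.Properties using (∈-lookup; ∈-map⁺; ∈-map⁻; ∈-filter⁺; ∈-filter⁻; ∈-++⁺ˡ; ∈-++⁺ʳ; ∈-++⁻; ∈-tabulate⁺; ∈-tabulate⁻)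
open import Data.List.Relation.Unary.Any as Any using (here; there)
import Data.List.Relation.Unary.Any.Properties as Any
open import Data.Nat.Induction using (<-wellFounded)
open import Induction.WellFounded using (Acc; acc)
open import Data.List.Relation.Unary.Unique.Propositional using (Unique)
open import Data.List.Relation.Unary.AllPairs using (_∷_; [])
open import Data.List.Relation.Unary.All as All using ([]; _∷_)
open import Data.Maybe using (Maybe; just; nothing)
open import Data.Maybe.Properties using (just-injective)
open import Data.Product.Properties using (,-injective)
open import Relation.Binary.Definitions using (tri<; tri≈; tri>)

-- The obstacle is that the proof has to speak of curves and discs with nothing but a list of faces.
-- A side of a 3-cycle is therefore a Boolean function on vertices: constant along edges that avoid
-- the cycle, and different at the two third vertices of the faces on each edge of the cycle. It is
-- enough to check the change across one edge. A vertex link minus one vertex stays connected, so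
-- the change turns around the corners of a nonfacial cycle to the other two edges. A function can
-- thus be tested on whichever edge is most convenient, such as one away from the contraction. A
-- disc is such a function that also avoids the frame. This condition fits the operations:
-- contracted edges have both ends off the frame, so frame vertices are fixed and never merged,
-- while a vertex of degree 3 swallowed by a contraction is no frame vertex and its star is a disc.
-- In the cut surface the same condition prevents a 3-cycle of the original triangulation from
-- having been opened inside a disc, because an opening happens only at frame vertices.

-- Links of vertices in a closed surface

infixl 9 _[_↦_]

_[_↦_] : {A : Set} → (ℕ → A) → ℕ → A → ℕ → A
(f [ j ↦ b ]) i = if does (i ≟ j) then b else f i

update-at : ∀ {A : Set} (f : ℕ → A) j {b} → (f [ j ↦ b ]) j ≡ b
update-at f j rewrite dec-true (j ≟ j) refl = refl

update-off : ∀ {A : Set} (f : ℕ → A) {j b i} → i ≢ j → (f [ j ↦ b ]) i ≡ f i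
update-off f {j} {i = i} i≢j rewrite dec-false (i ≟ j) i≢j = refl

parity : ℕ → (ℕ → Bool) → Bool
parity zero f = false
parity (suc n) f = f n xor parity n f

parity-cong : ∀ n {f g} → (∀ i → f i ≡ g i) → parity n f ≡ parity n g
parity-cong zero h = refl
parity-cong (suc n) h = cong₂ _xor_ (h n) (parity-cong n h)

xor-interchange : ∀ a b c d → (a xor b) xor (c xor d) ≡ (a xor c) xor (b xor d)
xor-interchange a b c d = begin
  (a xor b) xor (c xor d)  ≡⟨ xor-assoc a b (c xor d) ⟩
  a xor (b xor (c xor d))  ≡⟨ cong (a xor_) (sym (xor-assoc b c d)) ⟩
  a xor ((b xor c) xor d)  ≡⟨ cong (λ e → a xor (e xor d)) (xor-comm b c) ⟩
  a xor ((c xor b) xor d)  ≡⟨ cong (a xor_) (xor-assoc c b d) ⟩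
  a xor (c xor (b xor d))  ≡⟨ sym (xor-assoc a c (b xor d)) ⟩
  (a xor c) xor (b xor d)  ∎
  where open ≡-Reasoning

xor-≢ : ∀ {a b} → a ≢ b → a xor b ≡ true
xor-≢ {false} {false} a≢b = contradiction refl a≢b
xor-≢ {false} {true} _ = refl
xor-≢ {true} {false} _ = refl
xor-≢ {true} {true} a≢b = contradiction refl a≢b

parity-xor : ∀ n f g → parity n (λ i → f i xor g i) ≡ parity n f xor parity n g
parity-xor zero f g = refl
parity-xor (suc n) f g =
  trans (cong ((f n xor g n) xor_) (parity-xor n f g)) (xor-interchange (f n) (g n) _ _)

parity-single : ∀ n {f j} → j ℕ.< n → (∀ i → i ≢ j → f i ≡ false) → parity n f ≡ f j
parity-single (suc n) {f} {j} j<1+n h with n ≟ j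
... | yes refl = trans (cong (f n xor_) (below n (λ i i<n → h i λ { refl → <-irrefl refl i<n })))
                       (xor-identityʳ (f n))
  where
  below : ∀ m {g} → (∀ i → i ℕ.< m → g i ≡ false) → parity m g ≡ false
  below zero k = refl
  below (suc m) k = cong₂ _xor_ (k m (n<1+n m)) (below m λ i i<m → k i (m<n⇒m<1+n i<m))
... | no n≢j with m<1+n⇒m<n∨m≡n j<1+n
...   | inj₁ j<n = cong₂ _xor_ (h n n≢j) (parity-single n j<n h)
...   | inj₂ refl = contradiction refl n≢j

parity-pair : ∀ n {f j k} → j ℕ.< n → k ℕ.< n → j ≢ k →
  (∀ i → i ≢ j → i ≢ k → f i ≡ false) → parity n f ≡ f j xor f k
parity-pair n {f} {j} {k} j<n k<n j≢k h = begin
  parity n f                       ≡⟨ parity-cong n split ⟩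
  parity n (λ i → at i xor off i)  ≡⟨ parity-xor n at off ⟩
  parity n at xor parity n off     ≡⟨ cong₂ _xor_ (parity-single n j<n λ _ → update-off (λ _ → false)) (parity-single n k<n off-false) ⟩
  at j xor off k                   ≡⟨ cong₂ _xor_ (update-at (λ _ → false) j) (update-off f (j≢k ∘ sym)) ⟩
  f j xor f k                      ∎
  where
  open ≡-Reasoning
  at off : ℕ → Bool
  at = (λ _ → false) [ j ↦ f j ]
  off = f [ j ↦ false ]
  split : ∀ i → f i ≡ at i xor off i
  split i with does (i ≟ j) | proof (i ≟ j)
  ... | true | ofʸ refl = sym (xor-identityʳ _)
  ... | false | _ = refl
  off-false : ∀ i → i ≢ k → off i ≡ false
  off-false i i≢k with does (i ≟ j) | proof (i ≟ j)
  ... | true | _ = refl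
  ... | false | ofⁿ i≢j = h i i≢j i≢k

parity-true : ∀ n {f} → parity n f ≡ true → ∃ λ i → f i ≡ true
parity-true (suc n) {f} h with f n in fn
... | true = n , fn
... | false = parity-true n h

-- Handshake lemma modulo 2: `m i j` and `m j i` cancel and the diagonal vanishes. The induction
-- strips the last row and the last column, which are equal.
parity-symmetric : ∀ n (m : ℕ → ℕ → Bool) → (∀ i j → m i j ≡ m j i) → (∀ i → m i i ≡ false) →
  parity n (λ i → parity n (m i)) ≡ false
parity-symmetric zero m m-sym m-diag = refl
parity-symmetric (suc n) m m-sym m-diag = begin
  (m n n xor row) xor parity n (λ i → m i n xor parity n (m i))
    ≡⟨ cong₂ _xor_ (cong (_xor row) (m-diag n)) (parity-xor n (λ i → m i n) (λ i → parity n (m i))) ⟩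
  row xor (parity n (λ i → m i n) xor parity n (λ i → parity n (m i)))
    ≡⟨ cong (row xor_) (cong₂ _xor_ (parity-cong n λ i → m-sym i n) (parity-symmetric n m m-sym m-diag)) ⟩
  row xor (row xor false)  ≡⟨ cong (row xor_) (xor-identityʳ row) ⟩
  row xor row              ≡⟨ xor-same row ⟩
  false                    ∎
  where
  open ≡-Reasoning
  row = parity n (m n)

Triangles : Set₁
Triangles = ℕ → ℕ → ℕ → Set

Edge : Triangles → ℕ → ℕ → Set
Edge Tri p q = ∃ λ r → Tri p q r

-- Faces as a decidable symmetric relation keep face indices out of the topological arguments.
-- `bound` makes sums and counts over vertices finite.
record Surface (Tri : Triangles) : Set where
  field
    tri?     : ∀ p q r → Dec (Tri p q r)
    distinct : ∀ {p q r} → Tri p q r → p ≢ q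
    swap₁₂   : ∀ {p q r} → Tri p q r → Tri q p r
    swap₂₃   : ∀ {p q r} → Tri p q r → Tri p r q
    bound    : ℕ
    bounded  : ∀ {p q r} → Tri p q r → p ℕ.< bound
    opposite : ∀ {p q r} → Tri p q r →
      ∃ λ r′ → r′ ≢ r × Tri p q r′ × (∀ s → Tri p q s → s ≡ r ⊎ s ≡ r′)
    link     : ∀ {x y z} → Edge Tri x y → Edge Tri x z → Reach (Tri x) y z

  distinct₂₃ : ∀ {p q r} → Tri p q r → q ≢ r
  distinct₂₃ = distinct ∘ swap₂₃ ∘ swap₁₂

  distinct₁₃ : ∀ {p q r} → Tri p q r → p ≢ r
  distinct₁₃ = distinct ∘ swap₂₃

  edge-sym : ∀ {p q} → Edge Tri p q → Edge Tri q p
  edge-sym (r , t) = r , swap₁₂ t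

  edge-≢ : ∀ {p q} → Edge Tri p q → p ≢ q
  edge-≢ (_ , t) = distinct t

  edge₁₃ : ∀ {p q r} → Tri p q r → Edge Tri p r
  edge₁₃ t = _ , swap₂₃ t

  edge₂₃ : ∀ {p q r} → Tri p q r → Edge Tri q r
  edge₂₃ t = edge₁₃ (swap₁₂ t)

  two-thirds : ∀ {p q r r′} → Tri p q r → Tri p q r′ → r ≢ r′ →
    ∀ {s} → Tri p q s → s ≡ r ⊎ s ≡ r′
  two-thirds t t′ r≢r′ u with opposite t
  ... | o , _ , _ , only with only _ t′ | only _ u
  ... | inj₁ refl | _ = contradiction refl r≢r′
  ... | inj₂ refl | v = v

  other-third : ∀ {p q r s s′} → Tri p q r → Tri p q s → Tri p q s′ → s ≢ r → s′ ≢ r → s ≡ s′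
  other-third {s = s} {s′} t u u′ s≢r s′≢r with two-thirds t u (s≢r ∘ sym) u′
  ... | inj₁ e = contradiction e s′≢r
  ... | inj₂ e = sym e

-- The link of x is 2-regular and connected.  If removing y disconnected it, then κ, extended to y
-- by its value on one side, would change along exactly one edge of the link, whereas an even number
-- of edges of a 2-regular graph leave any vertex set.
module _ {Tri : Triangles} (S : Surface Tri) where
  open Surface S

  link-minus-vertex : ∀ {x y} (κ : ℕ → Bool) → Edge Tri x y →
    (∀ {q r} → Tri x q r → q ≢ y → r ≢ y → κ q ≡ κ r) →
    ∀ {q r} → Edge Tri x q → Edge Tri x r → q ≢ y → r ≢ y → κ q ≡ κ r
  link-minus-vertex {x} {y} κ (n , xyn) const {q} {r} xq xr q≢y r≢y = begin
    κ q   ≡⟨ sym (update-off κ q≢y) ⟩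
    κ⁺ q  ≡⟨ along (link xq xr) ⟩
    κ⁺ r  ≡⟨ update-off κ r≢y ⟩
    κ r   ∎
    where
    open ≡-Reasoning
    n′ = proj₁ (opposite xyn)
    n′≢n = proj₁ (proj₂ (opposite xyn))
    xyn′ = proj₁ (proj₂ (proj₂ (opposite xyn)))

    κ⁺ : ℕ → Bool
    κ⁺ = κ [ y ↦ κ n ]

    K : ℕ → Bool
    K q = κ⁺ q xor κ n′

    -- Adjacency matrix of the subgraph of the link of x induced on the vertices where `K` holds;
    -- its row sums are degrees modulo 2.
    M : ℕ → ℕ → Bool
    M q r = does (tri? x q r) ∧ (K q ∧ K r)

    M-false : ∀ q r → ¬ Tri x q r → M q r ≡ false
    M-false q r ¬t rewrite dec-false (tri? x q r) ¬t = refl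

    M-true : ∀ {q r} → Tri x q r → M q r ≡ K q ∧ K r
    M-true {q} {r} t rewrite dec-true (tri? x q r) t = refl

    M-sym : ∀ i j → M i j ≡ M j i
    M-sym i j with tri? x i j | tri? x j i
    ... | yes _ | yes _ = ∧-comm (K i) (K j)
    ... | yes t | no ¬t = contradiction (swap₂₃ t) ¬t
    ... | no ¬t | yes t = contradiction (swap₂₃ t) ¬t
    ... | no _ | no _ = refl

    row : ℕ → Bool
    row q = parity bound (M q)

    row-link : ∀ {q s s′} → Tri x q s → Tri x q s′ → s ≢ s′ → row q ≡ (K q ∧ K s) xor (K q ∧ K s′)
    row-link {q} {s} {s′} t t′ s≢s′ = trans
      (parity-pair bound (bounded (swap₁₂ (swap₂₃ t))) (bounded (swap₁₂ (swap₂₃ t′))) s≢s′ λ i i≢s i≢s′ →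
        M-false q i λ u → [ i≢s , i≢s′ ]′ (two-thirds t t′ s≢s′ u))
      (cong₂ _xor_ (M-true t) (M-true t′))

    K-step : ∀ {q r} → q ≢ y → Tri x q r → K q ≡ true → κ n ≢ κ n′ → K r ≡ true
    K-step {q} {r} q≢y t Kq n≢n′ with r ≟ y
    ... | yes refl = trans (cong (_xor κ n′) (update-at κ r)) (xor-≢ n≢n′)
    ... | no r≢y = trans (cong (_xor κ n′) κ⁺r≡κ⁺q) Kq
      where
      κ⁺r≡κ⁺q : κ⁺ r ≡ κ⁺ q
      κ⁺r≡κ⁺q = trans (update-off κ r≢y) (trans (sym (const t q≢y r≢y)) (sym (update-off κ q≢y)))

    -- A nonzero row forces `K q`; then both link neighbours of q satisfy `K` as well, so the degree
    -- of q is 2.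
    row-off : κ n ≢ κ n′ → ∀ q → q ≢ y → row q ≡ false
    row-off n≢n′ q q≢y with row q Bool.≟ true
    ... | no ¬true = ¬-not ¬true
    ... | yes eq with parity-true bound eq
    ...   | i , Mqi with tri? x q i
    ...     | yes t =
              let s , s≢i , t′ , _ = opposite t
                  Kq = ∧-conicalˡ (K q) (K i) Mqi
              in trans (row-link t t′ (s≢i ∘ sym))
                   (cong₂ _xor_ (cong₂ _∧_ Kq (K-step q≢y t Kq n≢n′)) (cong₂ _∧_ Kq (K-step q≢y t′ Kq n≢n′)))

    row-y : κ n ≢ κ n′ → row y ≡ true
    row-y n≢n′ = trans (row-link xyn xyn′ (n′≢n ∘ sym))
      (cong₂ _xor_ (cong₂ _∧_ K-y K-n) (cong₂ _∧_ K-y K-n′))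
      where
      K-y : K y ≡ true
      K-y = trans (cong (_xor κ n′) (update-at κ y)) (xor-≢ n≢n′)
      K-n : K n ≡ true
      K-n = trans (cong (_xor κ n′) (update-off κ (distinct₂₃ xyn ∘ sym))) (xor-≢ n≢n′)
      K-n′ : K n′ ≡ false
      K-n′ = trans (cong (_xor κ n′) (update-off κ (distinct₂₃ xyn′ ∘ sym))) (xor-same (κ n′))

    ends-agree : κ n ≡ κ n′
    ends-agree with κ n Bool.≟ κ n′
    ... | yes e = e
    -- Otherwise y would be the only vertex of odd degree: n counts as its neighbour and n′ does
    -- not.
    ... | no n≢n′ = contradiction
      (trans (sym (row-y n≢n′)) (trans (sym (parity-single bound (bounded (swap₁₂ xyn)) (row-off n≢n′)))
        (parity-symmetric bound M M-sym λ i → M-false i i λ t → distinct₂₃ t refl))) λ ()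

    near-y : ∀ {r} → Tri x y r → κ r ≡ κ n
    near-y t with two-thirds xyn xyn′ (n′≢n ∘ sym) t
    ... | inj₁ refl = refl
    ... | inj₂ refl = sym ends-agree

    κ⁺-step : ∀ {q r} → Tri x q r → κ⁺ q ≡ κ⁺ r
    κ⁺-step {q} {r} t with does (q ≟ y) | proof (q ≟ y) | does (r ≟ y) | proof (r ≟ y)
    ... | true | _ | true | _ = refl
    ... | true | ofʸ refl | false | _ = sym (near-y t)
    ... | false | _ | true | ofʸ refl = near-y (swap₂₃ t)
    ... | false | ofⁿ q≢y | false | ofⁿ r≢y = const t q≢y r≢y

    along : ∀ {q r} → Reach (Tri x) q r → κ⁺ q ≡ κ⁺ r
    along here = refl
    along (there t ts) = trans (κ⁺-step t) (along ts)

-- Separating 3-cycles and discs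

Off : ℕ → ℕ → ℕ → ℕ → Set
Off p q r s = s ≢ p × s ≢ q × s ≢ r

On : ℕ → ℕ → ℕ → ℕ → Set
On p q r s = s ≡ p ⊎ s ≡ q ⊎ s ≡ r

on? : ∀ p q r s → On p q r s ⊎ Off p q r s
on? p q r s with s ≟ p | s ≟ q | s ≟ r
... | yes e | _ | _ = inj₁ (inj₁ e)
... | no _ | yes e | _ = inj₁ (inj₂ (inj₁ e))
... | no _ | no _ | yes e = inj₁ (inj₂ (inj₂ e))
... | no a | no b | no c = inj₂ (a , b , c)

on-off : ∀ {p q r s} → On p q r s → ¬ Off p q r s
on-off (inj₁ e) (a , _) = a e
on-off (inj₂ (inj₁ e)) (_ , b , _) = b e
on-off (inj₂ (inj₂ e)) (_ , _ , c) = c e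

off-swap₁₂ : ∀ {p q r s} → Off p q r s → Off q p r s
off-swap₁₂ (a , b , c) = b , a , c

off-swap₂₃ : ∀ {p q r s} → Off p q r s → Off p r q s
off-swap₂₃ (a , b , c) = a , c , b

on-swap₁₂ : ∀ {p q r s} → On p q r s → On q p r s
on-swap₁₂ (inj₁ e) = inj₂ (inj₁ e)
on-swap₁₂ (inj₂ (inj₁ e)) = inj₁ e
on-swap₁₂ (inj₂ (inj₂ e)) = inj₂ (inj₂ e)

on-swap₂₃ : ∀ {p q r s} → On p q r s → On p r q s
on-swap₂₃ (inj₁ e) = inj₁ e
on-swap₂₃ (inj₂ (inj₁ e)) = inj₂ (inj₂ e)
on-swap₂₃ (inj₂ (inj₂ e)) = inj₂ (inj₁ e)

-- P is closed under permuting the triple, hence depends on the set only.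
permute : ∀ (P : ℕ → ℕ → ℕ → Set) →
  (∀ {p q r} → P p q r → P q p r) → (∀ {p q r} → P p q r → P p r q) →
  ∀ {x y z p q r} → On x y z p → On x y z q → On x y z r → p ≢ q → p ≢ r → q ≢ r → P x y z → P p q r
permute P σ τ = go
  where
  go : ∀ {x y z p q r} → On x y z p → On x y z q → On x y z r → p ≢ q → p ≢ r → q ≢ r → P x y z → P p q r
  go (inj₁ refl) (inj₁ refl) _ a b c h = contradiction refl a
  go (inj₁ refl) _ (inj₁ refl) a b c h = contradiction refl b
  go (inj₁ refl) (inj₂ (inj₁ refl)) (inj₂ (inj₁ refl)) a b c h = contradiction refl c
  go (inj₁ refl) (inj₂ (inj₁ refl)) (inj₂ (inj₂ refl)) a b c h = h
  go (inj₁ refl) (inj₂ (inj₂ refl)) (inj₂ (inj₁ refl)) a b c h = τ h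
  go (inj₁ refl) (inj₂ (inj₂ refl)) (inj₂ (inj₂ refl)) a b c h = contradiction refl c
  go (inj₂ (inj₁ refl)) (inj₁ refl) (inj₁ refl) a b c h = contradiction refl c
  go (inj₂ (inj₁ refl)) (inj₁ refl) (inj₂ (inj₁ refl)) a b c h = contradiction refl b
  go (inj₂ (inj₁ refl)) (inj₁ refl) (inj₂ (inj₂ refl)) a b c h = σ h
  go (inj₂ (inj₁ refl)) (inj₂ (inj₁ refl)) _ a b c h = contradiction refl a
  go (inj₂ (inj₁ refl)) (inj₂ (inj₂ refl)) (inj₁ refl) a b c h = τ (σ h)
  go (inj₂ (inj₁ refl)) (inj₂ (inj₂ refl)) (inj₂ (inj₁ refl)) a b c h = contradiction refl b
  go (inj₂ (inj₁ refl)) (inj₂ (inj₂ refl)) (inj₂ (inj₂ refl)) a b c h = contradiction refl c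
  go (inj₂ (inj₂ refl)) (inj₁ refl) (inj₁ refl) a b c h = contradiction refl c
  go (inj₂ (inj₂ refl)) (inj₁ refl) (inj₂ (inj₁ refl)) a b c h = σ (τ h)
  go (inj₂ (inj₂ refl)) (inj₁ refl) (inj₂ (inj₂ refl)) a b c h = contradiction refl b
  go (inj₂ (inj₂ refl)) (inj₂ (inj₁ refl)) (inj₁ refl) a b c h = τ (σ (τ h))
  go (inj₂ (inj₂ refl)) (inj₂ (inj₁ refl)) (inj₂ (inj₁ refl)) a b c h = contradiction refl c
  go (inj₂ (inj₂ refl)) (inj₂ (inj₁ refl)) (inj₂ (inj₂ refl)) a b c h = contradiction refl b
  go (inj₂ (inj₂ refl)) (inj₂ (inj₂ refl)) _ a b c h = contradiction refl a

record Cycle (Tri : Triangles) (p q r : ℕ) : Set where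
  constructor cycle
  field
    edge₁₂   : Edge Tri p q
    edge₁₃   : Edge Tri p r
    edge₂₃   : Edge Tri q r
    nonfacial : ¬ Tri p q r

Differs : Triangles → (ℕ → Bool) → ℕ → ℕ → Set
Differs Tri K p q = ∀ {α β} → Tri p q α → Tri p q β → α ≢ β → K α ≢ K β

-- The values of `K` on p, q, r themselves are free. For a nonfacial cycle the third vertices in
-- `Differs` lie off it, so `K` is meaningful there.
record Separates (Tri : Triangles) (p q r : ℕ) (K : ℕ → Bool) : Set where
  field
    const     : ∀ {s t} → Edge Tri s t → Off p q r s → Off p q r t → K s ≡ K t
    differs₁₂ : Differs Tri K p q
    differs₁₃ : Differs Tri K p r
    differs₂₃ : Differs Tri K q r

Separable : Triangles → ℕ → ℕ → ℕ → Set
Separable Tri p q r = ∃ (Separates Tri p q r)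

-- For nonfacial xyz, inside is the interior of a disc with boundary xyz; instead of
-- simple connectedness we record the only consequence needed, that 3-cycles in it separate.
record Disc (Tri : Triangles) (Frame : ℕ → Set) (x y z : ℕ) : Set where
  field
    inside     : ℕ → Bool
    normal     : ∀ {s} → On x y z s → inside s ≡ false
    off-frame  : ∀ {s} → inside s ≡ true → ¬ Frame s
    separates  : Separates Tri x y z inside
    separable  : ∀ {p q r} →
      inside p ≡ true ⊎ On x y z p → inside q ≡ true ⊎ On x y z q → inside r ≡ true ⊎ On x y z r →
      Cycle Tri p q r → Separable Tri p q r

module Separation {Tri : Triangles} (S : Surface Tri) where
  open Surface S

  cycle-swap₁₂ : ∀ {p q r} → Cycle Tri p q r → Cycle Tri q p r
  cycle-swap₁₂ (cycle a b c n) = cycle (edge-sym a) c b (n ∘ swap₁₂)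

  cycle-swap₂₃ : ∀ {p q r} → Cycle Tri p q r → Cycle Tri p r q
  cycle-swap₂₃ (cycle a b c n) = cycle b a (edge-sym c) (n ∘ swap₂₃)

  differs-sym : ∀ {K p q} → Differs Tri K p q → Differs Tri K q p
  differs-sym d t u = d (swap₁₂ t) (swap₁₂ u)

  separates-swap₁₂ : ∀ {p q r K} → Separates Tri p q r K → Separates Tri q p r K
  separates-swap₁₂ s = record
    { const = λ e o o′ → const e (off-swap₁₂ o) (off-swap₁₂ o′)
    ; differs₁₂ = differs-sym differs₁₂ ; differs₁₃ = differs₂₃ ; differs₂₃ = differs₁₃ }
    where open Separates s

  separates-swap₂₃ : ∀ {p q r K} → Separates Tri p q r K → Separates Tri p r q K
  separates-swap₂₃ s = record
    { const = λ e o o′ → const e (off-swap₂₃ o) (off-swap₂₃ o′)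
    ; differs₁₂ = differs₁₃ ; differs₁₃ = differs₁₂ ; differs₂₃ = differs-sym differs₂₃ }
    where open Separates s

  disc-swap₁₂ : ∀ {Frame x y z} → Disc Tri Frame x y z → Disc Tri Frame y x z
  disc-swap₁₂ {x = x} {y} {z} d = record
    { inside = inside ; normal = normal ∘ on-swap₁₂ ; off-frame = off-frame
    ; separates = separates-swap₁₂ separates
    ; separable = λ a b c → separable (turn a) (turn b) (turn c) }
    where
    open Disc d
    turn : ∀ {s} → inside s ≡ true ⊎ On y x z s → inside s ≡ true ⊎ On x y z s
    turn (inj₁ i) = inj₁ i
    turn (inj₂ o) = inj₂ (on-swap₁₂ o)

  disc-swap₂₃ : ∀ {Frame x y z} → Disc Tri Frame x y z → Disc Tri Frame x z y
  disc-swap₂₃ {x = x} {y} {z} d = record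
    { inside = inside ; normal = normal ∘ on-swap₂₃ ; off-frame = off-frame
    ; separates = separates-swap₂₃ separates
    ; separable = λ a b c → separable (turn a) (turn b) (turn c) }
    where
    open Disc d
    turn : ∀ {s} → inside s ≡ true ⊎ On x z y s → inside s ≡ true ⊎ On x y z s
    turn (inj₁ i) = inj₁ i
    turn (inj₂ o) = inj₂ (on-swap₂₃ o)

  module _ {p q r : ℕ} {K : ℕ → Bool} (c : Cycle Tri p q r)
           (const : ∀ {s t} → Edge Tri s t → Off p q r s → Off p q r t → K s ≡ K t) where
    open Cycle c renaming (edge₁₂ to pq; edge₁₃ to pr; edge₂₃ to qr)

    -- If `K` agreed on both sides of pr, then giving r that common value would make it constant
    -- along the link of p away from q. The link minus q is connected, so the two neighbours of q in
    -- it would agree, against the change across pq. They differ from r because the cycle is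
    -- nonfacial.
    differs-turn : Differs Tri K p q → Differs Tri K p r
    differs-turn d {γ} {δ} prγ prδ γ≢δ Kγ≡Kδ = d pqα pqβ α≢β Kα≡Kβ
      where
      α = proj₁ pq
      pqα = proj₂ pq
      β = proj₁ (opposite pqα)
      pqβ = proj₁ (proj₂ (proj₂ (opposite pqα)))
      α≢β : α ≢ β
      α≢β = proj₁ (proj₂ (opposite pqα)) ∘ sym
      κ = K [ r ↦ K γ ]
      near-r : ∀ {t} → Tri p r t → K t ≡ K γ
      near-r u with two-thirds prγ prδ γ≢δ u
      ... | inj₁ refl = refl
      ... | inj₂ refl = sym Kγ≡Kδ
      κ-const : ∀ {s t} → Tri p s t → s ≢ q → t ≢ q → κ s ≡ κ t
      κ-const {s} {t} u s≢q t≢q = by-cases (s ≟ r) (t ≟ r)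
        where
        by-cases : Dec (s ≡ r) → Dec (t ≡ r) → κ s ≡ κ t
        by-cases (yes refl) (yes refl) = refl
        by-cases (yes refl) (no t≢r) = trans (update-at K r) (sym (trans (update-off K t≢r) (near-r u)))
        by-cases (no s≢r) (yes refl) = trans (update-off K s≢r) (trans (near-r (swap₂₃ u)) (sym (update-at K r)))
        by-cases (no s≢r) (no t≢r) = trans (update-off K s≢r) (trans
          (const (edge₂₃ u) (distinct u ∘ sym , s≢q , s≢r) (distinct₁₃ u ∘ sym , t≢q , t≢r))
          (sym (update-off K t≢r)))
      off-r : ∀ {t} → Tri p q t → t ≢ r
      off-r u refl = nonfacial u
      Kα≡Kβ : K α ≡ K β
      Kα≡Kβ = trans (sym (update-off K (off-r pqα))) (trans
        (link-minus-vertex S κ pq κ-const (edge₁₃ pqα) (edge₁₃ pqβ)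
          (distinct₂₃ pqα ∘ sym) (distinct₂₃ pqβ ∘ sym))
        (update-off K (off-r pqβ)))

  -- The change across pq turns around p to pr and around q to qr.
  separates-from-edge : ∀ {p q r K} → Cycle Tri p q r →
    (∀ {s t} → Edge Tri s t → Off p q r s → Off p q r t → K s ≡ K t) →
    Differs Tri K p q → Separates Tri p q r K
  separates-from-edge c const d = record
    { const = const
    ; differs₁₂ = d
    ; differs₁₃ = differs-turn c const d
    ; differs₂₃ = differs-turn (cycle-swap₁₂ c) (λ e o o′ → const e (off-swap₁₂ o) (off-swap₁₂ o′)) (differs-sym d) }

  -- The star of a vertex o of degree 3, as a disc bounded by the link of o.
  module Star (Frame : ℕ → Set) {o p q r} (opq : Tri o p q) (opr : Tri o p r) (oqr : Tri o q r)
              (c : Cycle Tri p q r) (o-free : ¬ Frame o) where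

    -- The link of o already contains the closed triangle pqr; being 2-regular and connected, it has
    -- no room for more.
    neighbour : ∀ {s} → Edge Tri o s → On p q r s
    neighbour os = along (link (q , opq) os) (inj₁ refl)
      where
      next : ∀ {s t} → On p q r s → Tri o s t → On p q r t
      next (inj₁ refl) u with two-thirds opq opr (distinct₂₃ oqr) u
      ... | inj₁ e = inj₂ (inj₁ e)
      ... | inj₂ e = inj₂ (inj₂ e)
      next (inj₂ (inj₁ refl)) u with two-thirds (swap₂₃ opq) oqr (distinct₂₃ opr) u
      ... | inj₁ e = inj₁ e
      ... | inj₂ e = inj₂ (inj₂ e)
      next (inj₂ (inj₂ refl)) u with two-thirds (swap₂₃ opr) (swap₂₃ oqr) (distinct₂₃ opq) u
      ... | inj₁ e = inj₁ e
      ... | inj₂ e = inj₂ (inj₁ e)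
      along : ∀ {s t} → Reach (Tri o) s t → On p q r s → On p q r t
      along here on = on
      along (there u us) on = along us (next on u)

    o-off : Off p q r o
    o-off = distinct opq , distinct oqr , distinct₁₃ opr

    centre : ℕ → Bool
    centre = (λ _ → false) [ o ↦ true ]

    centre-o : centre o ≡ true
    centre-o = update-at (λ _ → false) o

    centre-false : ∀ {s} → s ≢ o → centre s ≡ false
    centre-false = update-off (λ _ → false)

    is-o : ∀ {s} → centre s ≡ true → s ≡ o
    is-o {s} h with s ≟ o
    ... | yes e = e
    ... | no n = contradiction (trans (sym h) (centre-false n)) λ ()

    star-separates : Separates Tri p q r centre
    star-separates = separates-from-edge c
      (λ {s} {t} e s-off t-off → trans
        (centre-false {s} λ { refl → on-off (neighbour e) t-off })
        (sym (centre-false {t} λ { refl → on-off (neighbour (edge-sym e)) s-off })))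
      pq-differs
      where
      opq′ = swap₂₃ (swap₁₂ opq)
      pq-differs : Differs Tri centre p q
      pq-differs {α} {β} t u α≢β with α ≟ o | β ≟ o
      ... | yes refl | _ = λ e → contradiction (trans (sym centre-o) (trans e (centre-false (α≢β ∘ sym)))) λ ()
      ... | no _ | yes refl = λ e → contradiction (trans (sym centre-o) (trans (sym e) (centre-false α≢β))) λ ()
      ... | no α≢o | no β≢o with two-thirds t u α≢β opq′
      ...   | inj₁ e = contradiction (sym e) α≢o
      ...   | inj₂ e = contradiction (sym e) β≢o

    facial : ∀ {s t} → On p q r s → On p q r t → s ≢ t → Tri o s t
    facial (inj₁ refl) (inj₁ refl) n = contradiction refl n
    facial (inj₁ refl) (inj₂ (inj₁ refl)) n = opq
    facial (inj₁ refl) (inj₂ (inj₂ refl)) n = opr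
    facial (inj₂ (inj₁ refl)) (inj₁ refl) n = swap₂₃ opq
    facial (inj₂ (inj₁ refl)) (inj₂ (inj₁ refl)) n = contradiction refl n
    facial (inj₂ (inj₁ refl)) (inj₂ (inj₂ refl)) n = oqr
    facial (inj₂ (inj₂ refl)) (inj₁ refl) n = swap₂₃ opr
    facial (inj₂ (inj₂ refl)) (inj₂ (inj₁ refl)) n = swap₂₃ oqr
    facial (inj₂ (inj₂ refl)) (inj₂ (inj₂ refl)) n = contradiction refl n

    -- A 3-cycle through o in the closed star is a face, so the only nonfacial one is the boundary,
    -- which the centre separates.
    star-separable : ∀ {s t u} →
      centre s ≡ true ⊎ On p q r s → centre t ≡ true ⊎ On p q r t → centre u ≡ true ⊎ On p q r u →
      Cycle Tri s t u → Separable Tri s t u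
    star-separable a b c′ d = by-cases (weaken a) (weaken b) (weaken c′) d
      where
      weaken : ∀ {s} → centre s ≡ true ⊎ On p q r s → s ≡ o ⊎ On p q r s
      weaken (inj₁ h) = inj₁ (is-o h)
      weaken (inj₂ h) = inj₂ h
      by-cases : ∀ {s t u} → s ≡ o ⊎ On p q r s → t ≡ o ⊎ On p q r t → u ≡ o ⊎ On p q r u →
        Cycle Tri s t u → Separable Tri s t u
      by-cases (inj₁ refl) _ _ (cycle e f g n) =
        contradiction (facial (neighbour e) (neighbour f) (edge-≢ g)) n
      by-cases (inj₂ _) (inj₁ refl) _ (cycle e f g n) =
        contradiction (swap₁₂ (facial (neighbour (edge-sym e)) (neighbour g) (edge-≢ f))) n
      by-cases (inj₂ _) (inj₂ _) (inj₁ refl) (cycle e f g n) =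
        contradiction (swap₂₃ (swap₁₂ (facial (neighbour (edge-sym f)) (neighbour (edge-sym g)) (edge-≢ e)))) n
      by-cases (inj₂ a) (inj₂ b) (inj₂ c) (cycle e f g n) =
        permute (Separable Tri) (λ (K , h) → K , separates-swap₁₂ h) (λ (K , h) → K , separates-swap₂₃ h)
          a b c (edge-≢ e) (edge-≢ f) (edge-≢ g) (centre , star-separates)

    star : Disc Tri Frame p q r
    star = record
      { inside = centre
      ; normal = λ {s} on → centre-false {s} λ { refl → on-off on o-off }
      ; off-frame = λ h → subst (¬_ ∘ Frame) (sym (is-o h)) o-free
      ; separates = star-separates
      ; separable = star-separable }

-- Contraction of an edge

Essential : Triangles → (ℕ → Set) → ℕ → ℕ → ℕ → Set
Essential Tri Frame x y z = Cycle Tri x y z × ¬ Disc Tri Frame x y z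

-- φ contracts the edge ac; a and c play symmetric roles.
record Merges (F G : Triangles) (φ : ℕ → ℕ) (a c : ℕ) : Set where
  field
    ac     : Edge F a c
    merge  : φ a ≡ φ c
    inj    : ∀ {s t} → φ s ≡ φ t → s ≡ t ⊎ (s ≡ a × t ≡ c) ⊎ (s ≡ c × t ≡ a)
    facial : ∀ {b} → Edge F a b → Edge F c b → F a c b
    push   : ∀ {p q r} → F p q r → φ p ≢ φ q → φ p ≢ φ r → φ q ≢ φ r → G (φ p) (φ q) (φ r)
    lift   : ∀ {p q r} → G p q r → ∃ λ p′ → ∃ λ q′ → ∃ λ r′ →
               F p′ q′ r′ × φ p′ ≡ p × φ q′ ≡ q × φ r′ ≡ r

module Contraction {F G : Triangles} (SF : Surface F) (SG : Surface G) {φ : ℕ → ℕ} where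
  open Surface SF
  open Separation SF
  private
    module G = Surface SG
    module GS = Separation SG

  flip : ∀ {a c} → Merges F G φ a c → Merges F G φ c a
  flip m = record
    { ac = edge-sym ac ; merge = sym merge
    ; inj = λ e → [ inj₁ , [ inj₂ ∘ inj₂ , inj₂ ∘ inj₁ ]′ ]′ (inj e)
    ; facial = λ e f → swap₁₂ (facial f e) ; push = push ; lift = lift }
    where open Merges m

  module _ {a c} (m : Merges F G φ a c) where
    open Merges m

    merged : ∀ {s t} → φ s ≡ φ t → s ≢ t → φ s ≡ φ a
    merged e s≢t with inj e
    ... | inj₁ s≡t = contradiction s≡t s≢t
    ... | inj₂ (inj₁ (refl , _)) = refl
    ... | inj₂ (inj₂ (refl , _)) = sym merge

    merged-partner : ∀ {s t u} → φ s ≡ φ t → s ≢ t → φ s ≡ φ u → s ≢ u → t ≡ u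
    merged-partner e s≢t f s≢u with inj e | inj f
    ... | inj₁ s≡t | _ = contradiction s≡t s≢t
    ... | _ | inj₁ s≡u = contradiction s≡u s≢u
    ... | inj₂ (inj₁ (refl , refl)) | inj₂ (inj₁ (_ , refl)) = refl
    ... | inj₂ (inj₁ (refl , refl)) | inj₂ (inj₂ (refl , refl)) = refl
    ... | inj₂ (inj₂ (refl , refl)) | inj₂ (inj₁ (refl , refl)) = refl
    ... | inj₂ (inj₂ (refl , refl)) | inj₂ (inj₂ (_ , refl)) = refl

    facial-merged : ∀ {s t b} → φ s ≡ φ t → s ≢ t → Edge F s b → Edge F t b → F s t b
    facial-merged e s≢t sb tb with inj e
    ... | inj₁ s≡t = contradiction s≡t s≢t
    ... | inj₂ (inj₁ (refl , refl)) = facial sb tb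
    ... | inj₂ (inj₂ (refl , refl)) = swap₁₂ (facial tb sb)

    -- Only one pair of vertices is merged, so at most one of the two faces at st collapses; the
    -- other one carries the image edge.
    φ-edge : ∀ {s t} → Edge F s t → φ s ≢ φ t → Edge G (φ s) (φ t)
    φ-edge {s} {t} (r , str) φs≢φt with opposite str
    ... | r′ , r′≢r , str′ , _ with φ s ≟ φ r | φ t ≟ φ r
    ... | no n | no n′ = φ r , push str φs≢φt n n′
    ... | yes e | _ = φ r′ , push str′ φs≢φt
          (λ e′ → r′≢r (sym (merged-partner e (distinct₁₃ str) e′ (distinct₁₃ str′))))
          (λ e′ → φs≢φt (trans (merged e (distinct₁₃ str)) (sym (merged e′ (distinct₂₃ str′)))))
    ... | no _ | yes e = φ r′ , push str′ φs≢φt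
          (λ e′ → φs≢φt (trans (merged e′ (distinct₁₃ str′)) (sym (merged e (distinct₂₃ str)))))
          (λ e′ → r′≢r (sym (merged-partner e (distinct₂₃ str) e′ (distinct₂₃ str′))))

    -- If p and q were the merged pair, r would be a common neighbour of a and c, and `facial` would
    -- make the cycle a face.
    φ-cycle-≢ : ∀ {p q r} → Cycle F p q r → φ p ≢ φ q
    φ-cycle-≢ (cycle pq pr qr nonfacial) e = nonfacial (facial-merged e (edge-≢ pq) pr qr)

    φ-cycle : ∀ {p q r} → Cycle F p q r → ¬ G (φ p) (φ q) (φ r) → Cycle G (φ p) (φ q) (φ r)
    φ-cycle C n = cycle
      (φ-edge (Cycle.edge₁₂ C) (φ-cycle-≢ C))
      (φ-edge (Cycle.edge₁₃ C) (φ-cycle-≢ (cycle-swap₂₃ C)))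
      (φ-edge (Cycle.edge₂₃ C) (φ-cycle-≢ (cycle-swap₂₃ (cycle-swap₁₂ C)))) n

    -- A 3-cycle becomes facial only by contracting an edge at a vertex of degree 3 next to it.
    star-at : ∀ {Frame p q r o} → ¬ Frame a → ¬ Frame c → Cycle F p q r →
      F p q o → φ o ≡ φ r → o ≢ r → Disc F Frame p q r
    star-at {Frame} {p} {q} {r} {o} ¬a ¬c C pqo e o≢r =
      Star.star Frame (swap₁₂ (swap₂₃ pqo))
        (swap₂₃ (facial-merged e o≢r (edge-sym (edge₁₃ pqo)) (edge-sym (Cycle.edge₁₃ C))))
        (swap₂₃ (facial-merged e o≢r (edge-sym (edge₂₃ pqo)) (edge-sym (Cycle.edge₂₃ C))))
        C (free (inj e))
      where
      free : o ≡ r ⊎ (o ≡ a × r ≡ c) ⊎ (o ≡ c × r ≡ a) → ¬ Frame o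
      free (inj₁ o≡r) = contradiction o≡r o≢r
      free (inj₂ (inj₁ (refl , _))) = ¬a
      free (inj₂ (inj₂ (refl , _))) = ¬c

    -- A face over the image agrees with the cycle except at exactly one corner o, which is merged
    -- with the cycle vertex it replaces. Deviation at two corners would merge two vertices of the
    -- cycle; no deviation would make the cycle facial. The disc is the star of o.
    facial-image-disc : ∀ {Frame p q r} → ¬ Frame a → ¬ Frame c → Cycle F p q r →
      G (φ p) (φ q) (φ r) → Disc F Frame p q r
    facial-image-disc {Frame} {p} {q} {r} ¬a ¬c C t with lift t
    ... | p′ , q′ , r′ , t′ , ep , eq , er with p′ ≟ p | q′ ≟ q | r′ ≟ r
    ... | yes refl | yes refl | yes refl = contradiction t′ (Cycle.nonfacial C)
    ... | yes refl | yes refl | no r′≢r = star-at ¬a ¬c C t′ er r′≢r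
    ... | yes refl | no q′≢q | yes refl =
          disc-swap₂₃ (star-at ¬a ¬c (cycle-swap₂₃ C) (swap₂₃ t′) eq q′≢q)
    ... | no p′≢p | yes refl | yes refl =
          disc-swap₁₂ (disc-swap₂₃ (star-at ¬a ¬c (cycle-swap₂₃ (cycle-swap₁₂ C)) (swap₂₃ (swap₁₂ t′)) ep p′≢p))
    ... | no n | no n′ | _ = contradiction
          (trans (sym ep) (trans (merged ep n) (trans (sym (merged eq n′)) eq))) (φ-cycle-≢ C)
    ... | no n | yes _ | no n′ = contradiction
          (trans (sym ep) (trans (merged ep n) (trans (sym (merged er n′)) er))) (φ-cycle-≢ (cycle-swap₂₃ C))
    ... | yes _ | no n | no n′ = contradiction
          (trans (sym eq) (trans (merged eq n) (trans (sym (merged er n′)) er)))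
          (φ-cycle-≢ (cycle-swap₂₃ (cycle-swap₁₂ C)))

    unmerged : ∀ {s t} → s ≢ a → s ≢ c → φ s ≡ φ t → s ≡ t
    unmerged s≢a s≢c e with inj e
    ... | inj₁ s≡t = s≡t
    ... | inj₂ (inj₁ (s≡a , _)) = contradiction s≡a s≢a
    ... | inj₂ (inj₂ (s≡c , _)) = contradiction s≡c s≢c

  -- The second clause keeps the pulled-back side over the closed disc below. Its last case is for
  -- an end of the contracted edge that lies off the cycle while its image lies on the image cycle.
  Pulled : (ℕ → Bool) → ℕ → ℕ → ℕ → Set
  Pulled K′ p q r = ∃ λ K → Separates F p q r K ×
    (∀ {s} → K s ≡ true → K′ (φ s) ≡ true ⊎ On p q r s ⊎ On (φ p) (φ q) (φ r) (φ s))

  pulled-swap₁₂ : ∀ K′ {p q r} → Pulled K′ p q r → Pulled K′ q p r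
  pulled-swap₁₂ _ (K , s , h) = K , separates-swap₁₂ s , λ e → turn (h e)
    where
    turn : ∀ {A : Set} {p q r s p′ q′ r′ s′} → A ⊎ On p q r s ⊎ On p′ q′ r′ s′ → A ⊎ On q p r s ⊎ On q′ p′ r′ s′
    turn (inj₁ x) = inj₁ x
    turn (inj₂ (inj₁ x)) = inj₂ (inj₁ (on-swap₁₂ x))
    turn (inj₂ (inj₂ x)) = inj₂ (inj₂ (on-swap₁₂ x))

  pulled-swap₂₃ : ∀ K′ {p q r} → Pulled K′ p q r → Pulled K′ p r q
  pulled-swap₂₃ _ (K , s , h) = K , separates-swap₂₃ s , λ e → turn (h e)
    where
    turn : ∀ {A : Set} {p q r s p′ q′ r′ s′} → A ⊎ On p q r s ⊎ On p′ q′ r′ s′ → A ⊎ On p r q s ⊎ On p′ r′ q′ s′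
    turn (inj₁ x) = inj₁ x
    turn (inj₂ (inj₁ x)) = inj₂ (inj₁ (on-swap₂₃ x))
    turn (inj₂ (inj₂ x)) = inj₂ (inj₂ (on-swap₂₃ x))

  module _ {a c} (m : Merges F G φ a c) {K′ : ℕ → Bool} where
    open Merges m

    -- K′ is constant on the part of the link of c outside a, and c gets that constant.
    pull-at : ∀ {q r} → Cycle F a q r → ¬ G (φ a) (φ q) (φ r) →
      Separates G (φ a) (φ q) (φ r) K′ → Pulled K′ a q r
    pull-at {q} {r} C ¬image S = K , separation , λ {s} → values s
      where
      open Cycle C renaming (edge₁₂ to aq; edge₁₃ to ar; edge₂₃ to qr)
      open Separates S renaming (const to const′)
      a≢c : a ≢ c
      a≢c = edge-≢ ac
      c≢q : c ≢ q
      c≢q refl = φ-cycle-≢ m C merge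
      c≢r : c ≢ r
      c≢r refl = φ-cycle-≢ m (cycle-swap₂₃ C) merge

      -- When c, t, a span a face, this is the neighbour of t in the link of c on the side away from
      -- a. The default t is immaterial.
      opp : ℕ → ℕ
      opp t with tri? c t a
      ... | yes u = proj₁ (opposite u)
      ... | no _ = t

      opp-unique : ∀ {t s} → F c t a → F c t s → s ≢ a → opp t ≡ s
      opp-unique {t} u v s≢a with tri? c t a
      ... | no n = contradiction u n
      ... | yes u′ with opposite u′
      ...   | o , o≢a , o-tri , _ = other-third u o-tri v o≢a s≢a

      -- `K′` carries no information on the image cycle, so a vertex of the cycle in the link of c
      -- borrows the value of its neighbour there.
      κ : ℕ → Bool
      κ t with on? a q r t
      ... | inj₁ _ = K′ (φ (opp t))
      ... | inj₂ _ = K′ (φ t)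

      κ-off : ∀ {t} → Off a q r t → κ t ≡ K′ (φ t)
      κ-off {t} off with on? a q r t
      ... | inj₁ on = contradiction off (on-off on)
      ... | inj₂ _ = refl

      const-off : ∀ {s t} → Edge F s t → Off a q r s → Off a q r t → s ≢ c → t ≢ c → K′ (φ s) ≡ K′ (φ t)
      const-off {s} {t} st s-off t-off s≢c t≢c =
        const′ (φ-edge m st (edge-≢ st ∘ unmerged m (proj₁ s-off) s≢c)) (image s-off s≢c) (image t-off t≢c)
        where
        image : ∀ {s} → Off a q r s → s ≢ c → Off (φ a) (φ q) (φ r) (φ s)
        image (s≢a , s≢q , s≢r) s≢c =
          s≢a ∘ unmerged m s≢a s≢c , s≢q ∘ unmerged m s≢a s≢c , s≢r ∘ unmerged m s≢a s≢c

      to-a : ∀ {t} → Edge F c t → On a q r t → t ≢ a → F c t a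
      to-a ct (inj₁ e) t≢a = contradiction e t≢a
      to-a ct (inj₂ (inj₁ refl)) t≢a = swap₂₃ (swap₁₂ (facial aq ct))
      to-a ct (inj₂ (inj₂ refl)) t≢a = swap₂₃ (swap₁₂ (facial ar ct))

      -- If q and r were consecutive in the link of c, the face cqr would be pushed onto the image
      -- cycle, which is assumed nonfacial.
      both-on : ∀ {s t} → F c s t → On a q r s → On a q r t → s ≢ a → t ≢ a → ⊥
      both-on u (inj₁ e) _ s≢a _ = s≢a e
      both-on u (inj₂ _) (inj₁ e) _ t≢a = t≢a e
      both-on u (inj₂ (inj₁ refl)) (inj₂ (inj₁ refl)) _ _ = distinct₂₃ u refl
      both-on u (inj₂ (inj₂ refl)) (inj₂ (inj₂ refl)) _ _ = distinct₂₃ u refl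
      both-on u (inj₂ (inj₁ refl)) (inj₂ (inj₂ refl)) _ _ = facial-image u
        where
        facial-image : F c q r → ⊥
        facial-image u = ¬image (subst (λ x → G x (φ q) (φ r)) (sym merge)
          (push u (φ-cycle-≢ m C ∘ trans merge) (φ-cycle-≢ m (cycle-swap₂₃ C) ∘ trans merge)
            (φ-cycle-≢ m (cycle-swap₂₃ (cycle-swap₁₂ C)))))
      both-on u (inj₂ (inj₂ refl)) (inj₂ (inj₁ refl)) s≢a t≢a =
        both-on (swap₂₃ u) (inj₂ (inj₁ refl)) (inj₂ (inj₂ refl)) t≢a s≢a

      κ-const : ∀ {s t} → F c s t → s ≢ a → t ≢ a → κ s ≡ κ t
      κ-const {s} {t} u s≢a t≢a with on? a q r s | on? a q r t
      ... | inj₁ on | inj₁ on′ = ⊥-elim (both-on u on on′ s≢a t≢a)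
      ... | inj₁ on | inj₂ _ = cong (K′ ∘ φ) (opp-unique (to-a (_ , u) on s≢a) u t≢a)
      ... | inj₂ _ | inj₁ on = cong (K′ ∘ φ)
            (sym (opp-unique (to-a (edge₁₃ u) on t≢a) (swap₂₃ u) s≢a))
      ... | inj₂ o | inj₂ o′ = const-off (edge₂₃ u) o o′ (distinct u ∘ sym) (distinct₁₃ u ∘ sym)

      b = proj₁ ac
      -- c lies off the cycle, but its image is that of a, where `K′` is free; hence the value at c
      -- has to be replaced.
      K : ℕ → Bool
      K = (K′ ∘ φ) [ c ↦ κ b ]

      K-near : ∀ {t} → Edge F c t → Off a q r t → K t ≡ K c
      K-near {t} ct off@(t≢a , _) = begin
        K t       ≡⟨ update-off (K′ ∘ φ) (edge-≢ ct ∘ sym) ⟩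
        K′ (φ t)  ≡⟨ sym (κ-off off) ⟩
        κ t       ≡⟨ link-minus-vertex SF κ (edge-sym ac) κ-const ct cb t≢a b≢a ⟩
        κ b       ≡⟨ sym (update-at (K′ ∘ φ) c) ⟩
        K c       ∎
        where
        open ≡-Reasoning
        cb = edge₁₃ (swap₁₂ (proj₂ ac))
        b≢a = distinct₁₃ (proj₂ ac) ∘ sym

      K-const : ∀ {s t} → Edge F s t → Off a q r s → Off a q r t → K s ≡ K t
      K-const {s} {t} st o o′ = by-cases (s ≟ c) (t ≟ c)
        where
        by-cases : Dec (s ≡ c) → Dec (t ≡ c) → K s ≡ K t
        by-cases (yes refl) _ = sym (K-near st o′)
        by-cases (no _) (yes refl) = K-near (edge-sym st) o
        by-cases (no s≢c) (no t≢c) = trans (update-off (K′ ∘ φ) s≢c)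
          (trans (const-off st o o′ s≢c t≢c) (sym (update-off (K′ ∘ φ) t≢c)))

      thirds-off : ∀ {α} → F q r α → α ≢ a × α ≢ c
      thirds-off u =
        (λ { refl → Cycle.nonfacial C (swap₁₂ (swap₂₃ u)) }) ,
        (λ { refl → both-on (swap₁₂ (swap₂₃ u)) (inj₂ (inj₁ refl)) (inj₂ (inj₂ refl))
                      (edge-≢ aq ∘ sym) (edge-≢ ar ∘ sym) })

      -- The edge opposite a is the one to test: the third vertices at qr are neither a nor c, so
      -- its faces survive the contraction and stay distinct.
      K-differs : Differs F K q r
      K-differs {α} {β} u v α≢β e = differs₂₃ (image u) (image v) (α≢β ∘ unmerged m α≢a α≢c)
        (trans (sym (update-off (K′ ∘ φ) α≢c)) (trans e (update-off (K′ ∘ φ) β≢c)))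
        where
        α≢a = proj₁ (thirds-off u)
        α≢c = proj₂ (thirds-off u)
        β≢c = proj₂ (thirds-off v)
        image : ∀ {α} → F q r α → G (φ q) (φ r) (φ α)
        image w = push w (φ-cycle-≢ m (cycle-swap₂₃ (cycle-swap₁₂ C)))
          (λ e → distinct₁₃ w (sym (unmerged m (proj₁ (thirds-off w)) (proj₂ (thirds-off w)) (sym e))))
          (λ e → distinct₂₃ w (sym (unmerged m (proj₁ (thirds-off w)) (proj₂ (thirds-off w)) (sym e))))

      separation : Separates F a q r K
      separation = separates-swap₁₂ (separates-swap₂₃ (separates-from-edge
        (cycle-swap₂₃ (cycle-swap₁₂ C))
        (λ e o o′ → K-const e (off-swap₁₂ (off-swap₂₃ o)) (off-swap₁₂ (off-swap₂₃ o′))) K-differs))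

      values : ∀ s → K s ≡ true → K′ (φ s) ≡ true ⊎ On a q r s ⊎ On (φ a) (φ q) (φ r) (φ s)
      values s h with s ≟ c
      ... | yes refl = inj₂ (inj₂ (inj₁ (sym merge)))
      ... | no s≢c = inj₁ (trans (sym (update-off (K′ ∘ φ) s≢c)) h)

    -- With a and c both off the cycle, vertices off the cycle have images off the image cycle, so
    -- composition with φ is already a separation.
    pull-away : ∀ {p q r} → Off p q r a → Off p q r c → Cycle F p q r →
      Separates G (φ p) (φ q) (φ r) K′ → Pulled K′ p q r
    pull-away {p} {q} {r} (a≢p , a≢q , a≢r) (c≢p , c≢q , c≢r) C S =
      K′ ∘ φ , separates-from-edge C K-const K-differs , inj₁
      where
      open Separates S renaming (const to const′)
      image : ∀ {s} → Off p q r s → Off (φ p) (φ q) (φ r) (φ s)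
      image (s≢p , s≢q , s≢r) =
        (λ e → s≢p (sym (unmerged m (a≢p ∘ sym) (c≢p ∘ sym) (sym e)))) ,
        (λ e → s≢q (sym (unmerged m (a≢q ∘ sym) (c≢q ∘ sym) (sym e)))) ,
        (λ e → s≢r (sym (unmerged m (a≢r ∘ sym) (c≢r ∘ sym) (sym e))))
      K-const : ∀ {s t} → Edge F s t → Off p q r s → Off p q r t → K′ (φ s) ≡ K′ (φ t)
      K-const {s} {t} st o o′ with φ s ≟ φ t
      ... | yes e = cong K′ e
      ... | no n = const′ (φ-edge m st n) (image o) (image o′)
      push-third : ∀ {α} → F p q α → G (φ p) (φ q) (φ α)
      push-third u = push u (φ-cycle-≢ m C)
        (distinct₁₃ u ∘ unmerged m (a≢p ∘ sym) (c≢p ∘ sym))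
        (distinct₂₃ u ∘ unmerged m (a≢q ∘ sym) (c≢q ∘ sym))
      -- If α and β were merged, the image of pq would lie on one face only.
      K-differs : Differs F (K′ ∘ φ) p q
      K-differs {α} {β} u v α≢β = differs₁₂ (push-third u) (push-third v) φα≢φβ
        where
        φα≢φβ : φ α ≢ φ β
        φα≢φβ e with G.opposite (push-third u)
        ... | γ , γ≢φα , w , _ with lift w
        ... | p′ , q′ , γ′ , w′ , ep , eq , refl
              with unmerged m (a≢p ∘ sym) (c≢p ∘ sym) (sym ep) | unmerged m (a≢q ∘ sym) (c≢q ∘ sym) (sym eq)
        ... | refl | refl with two-thirds u v α≢β w′
        ... | inj₁ refl = γ≢φα refl
        ... | inj₂ refl = γ≢φα (sym e)

    pull-on : ∀ {p q r} → On p q r a → Cycle F p q r → ¬ G (φ p) (φ q) (φ r) →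
      Separates G (φ p) (φ q) (φ r) K′ → Pulled K′ p q r
    pull-on (inj₁ refl) C n S = pull-at C n S
    pull-on (inj₂ (inj₁ refl)) C n S =
      pulled-swap₁₂ K′ (pull-at (cycle-swap₁₂ C) (n ∘ G.swap₁₂) (GS.separates-swap₁₂ S))
    pull-on (inj₂ (inj₂ refl)) C n S = pulled-swap₂₃ K′ (pulled-swap₁₂ K′
      (pull-at (cycle-swap₁₂ (cycle-swap₂₃ C)) (n ∘ G.swap₂₃ ∘ G.swap₁₂)
        (GS.separates-swap₁₂ (GS.separates-swap₂₃ S))))

  module _ {a c} (m : Merges F G φ a c) where

    pull : ∀ {K′ p q r} → Cycle F p q r → ¬ G (φ p) (φ q) (φ r) →
      Separates G (φ p) (φ q) (φ r) K′ → Pulled K′ p q r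
    pull {p = p} {q} {r} C n S with on? p q r a | on? p q r c
    ... | inj₁ on | _ = pull-on m on C n S
    ... | inj₂ _ | inj₁ on = pull-on (flip m) on C n S
    ... | inj₂ a-off | inj₂ c-off = pull-away m a-off c-off C S

    module _ {Frame : ℕ → Set} (¬a : ¬ Frame a) (¬c : ¬ Frame c)
             (fixed : ∀ {s} → Frame s → φ s ≡ s) where

      -- The interior is the pulled-back side, set to false on the cycle. A vertex off the cycle
      -- whose image lies on the image cycle is a or c, hence no frame vertex. A 3-cycle in the new
      -- closed disc either has a facial image, and then bounds a star, or has an image that
      -- separates, and this separation is pulled back.
      pull-disc : ∀ {p q r} → Cycle F p q r → ¬ G (φ p) (φ q) (φ r) →
        Disc G Frame (φ p) (φ q) (φ r) → Disc F Frame p q r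
      pull-disc {p} {q} {r} C n D = record
        { inside = inside
        ; normal = inside-on
        ; off-frame = off-frame
        ; separates = separates-from-edge C const differs
        ; separable = separable }
        where
        module D = Disc D
        pulled = pull C n D.separates
        K = proj₁ pulled
        module K = Separates (proj₁ (proj₂ pulled))

        inside : ℕ → Bool
        inside s with on? p q r s
        ... | inj₁ _ = false
        ... | inj₂ _ = K s

        inside-on : ∀ {s} → On p q r s → inside s ≡ false
        inside-on {s} on with on? p q r s
        ... | inj₁ _ = refl
        ... | inj₂ off = contradiction off (on-off on)

        inside-off : ∀ {s} → Off p q r s → inside s ≡ K s
        inside-off {s} off with on? p q r s
        ... | inj₁ on = contradiction off (on-off on)
        ... | inj₂ _ = refl

        image-inside : ∀ {s} → inside s ≡ true → D.inside (φ s) ≡ true ⊎ On (φ p) (φ q) (φ r) (φ s)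
        image-inside {s} h with on? p q r s
        ... | inj₂ off with proj₂ (proj₂ pulled) h
        ...   | inj₁ i = inj₁ i
        ...   | inj₂ (inj₁ on) = contradiction off (on-off on)
        ...   | inj₂ (inj₂ on) = inj₂ on

        image : ∀ {s} → inside s ≡ true ⊎ On p q r s → D.inside (φ s) ≡ true ⊎ On (φ p) (φ q) (φ r) (φ s)
        image (inj₁ h) = image-inside h
        image (inj₂ (inj₁ refl)) = inj₂ (inj₁ refl)
        image (inj₂ (inj₂ (inj₁ refl))) = inj₂ (inj₂ (inj₁ refl))
        image (inj₂ (inj₂ (inj₂ refl))) = inj₂ (inj₂ (inj₂ refl))

        off-frame : ∀ {s} → inside s ≡ true → ¬ Frame s
        off-frame {s} h frame with on? p q r s
        ... | inj₂ off with proj₂ (proj₂ pulled) h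
        ...   | inj₁ i = D.off-frame i (subst Frame (sym (fixed frame)) frame)
        ...   | inj₂ (inj₁ on) = contradiction off (on-off on)
        ...   | inj₂ (inj₂ on) = contradiction off (on-off (unimage on))
          where
          preimage : ∀ {t} → φ s ≡ φ t → s ≡ t
          preimage = unmerged m (λ { refl → ¬a frame }) (λ { refl → ¬c frame })
          unimage : On (φ p) (φ q) (φ r) (φ s) → On p q r s
          unimage = Sum.map preimage (Sum.map preimage preimage)

        const : ∀ {s t} → Edge F s t → Off p q r s → Off p q r t → inside s ≡ inside t
        const e o o′ = trans (inside-off o) (trans (K.const e o o′) (sym (inside-off o′)))

        differs : Differs F inside p q
        differs u v α≢β e = K.differs₁₂ u v α≢β
          (trans (sym (inside-off (third-off u))) (trans e (inside-off (third-off v))))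
          where
          third-off : ∀ {α} → F p q α → Off p q r α
          third-off w = distinct₁₃ w ∘ sym , distinct₂₃ w ∘ sym , λ { refl → Cycle.nonfacial C w }

        separable : ∀ {s t u} →
          inside s ≡ true ⊎ On p q r s → inside t ≡ true ⊎ On p q r t → inside u ≡ true ⊎ On p q r u →
          Cycle F s t u → Separable F s t u
        separable {s} {t} {u} hs ht hu C′ with G.tri? (φ s) (φ t) (φ u)
        ... | yes g = _ , Disc.separates (facial-image-disc m ¬a ¬c C′ g)
        ... | no n with D.separable (image hs) (image ht) (image hu) (φ-cycle m C′ n)
        ...   | _ , S = let K , S′ , _ = pull C′ n S in K , S′

      essential-push : ∀ {p q r} → Essential F Frame p q r → Essential G Frame (φ p) (φ q) (φ r)
      essential-push (C , ¬D) = φ-cycle m C nonfacial , ¬D ∘ pull-disc C nonfacial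
        where
        nonfacial = ¬D ∘ facial-image-disc m ¬a ¬c C

-- Triangulations as surfaces

pigeonhole₂ : ∀ {a b p q r : ℕ} → p ≡ a ⊎ p ≡ b → q ≡ a ⊎ q ≡ b → r ≡ a ⊎ r ≡ b →
  p ≢ q → p ≢ r → q ≢ r → ⊥
pigeonhole₂ (inj₁ refl) (inj₁ refl) _ p≢q _ _ = p≢q refl
pigeonhole₂ (inj₂ refl) (inj₂ refl) _ p≢q _ _ = p≢q refl
pigeonhole₂ (inj₁ refl) (inj₂ refl) (inj₁ refl) _ p≢r _ = p≢r refl
pigeonhole₂ (inj₂ refl) (inj₁ refl) (inj₂ refl) _ p≢r _ = p≢r refl
pigeonhole₂ (inj₁ refl) (inj₂ refl) (inj₂ refl) _ _ q≢r = q≢r refl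
pigeonhole₂ (inj₂ refl) (inj₁ refl) (inj₁ refl) _ _ q≢r = q≢r refl

corners-exhaust : ∀ f {p q r s} → p ∈ᶠ f → q ∈ᶠ f → r ∈ᶠ f → p ≢ q → p ≢ r → q ≢ r → s ∈ᶠ f → On p q r s
corners-exhaust f {p} {q} {r} {s} p∈ q∈ r∈ p≢q p≢r q≢r s∈ with on? p q r s
... | inj₁ on = on
... | inj₂ (s≢p , s≢q , s≢r) with remove f s∈
  where
  remove : ∀ f → s ∈ᶠ f → ∃₂ λ a b → ∀ {x} → x ∈ᶠ f → s ≢ x → x ≡ a ⊎ x ≡ b
  remove (a , b , c) (inj₁ refl) = b , c , λ where
    (inj₁ e) n → contradiction (sym e) n
    (inj₂ h) _ → h
  remove (a , b , c) (inj₂ (inj₁ refl)) = a , c , λ where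
    (inj₁ e) _ → inj₁ e
    (inj₂ (inj₁ e)) n → contradiction (sym e) n
    (inj₂ (inj₂ e)) _ → inj₂ e
  remove (a , b , c) (inj₂ (inj₂ refl)) = a , b , λ where
    (inj₁ e) _ → inj₁ e
    (inj₂ (inj₁ e)) _ → inj₂ e
    (inj₂ (inj₂ e)) n → contradiction (sym e) n
... | _ , _ , rest = ⊥-elim (pigeonhole₂ (rest p∈ s≢p) (rest q∈ s≢q) (rest r∈ s≢r) p≢q p≢r q≢r)

Proper : Face → Set
Proper (a , b , c) = a ≢ b × b ≢ c × a ≢ c

third-corner : ∀ f {x y} → Proper f → x ∈ᶠ f → y ∈ᶠ f → x ≢ y → ∃ λ r → r ∈ᶠ f × x ≢ r × y ≢ r
third-corner _ _ (inj₁ refl) (inj₁ refl) n = contradiction refl n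
third-corner _ (ab , bc , ac) (inj₁ refl) (inj₂ (inj₁ refl)) n = _ , inj₂ (inj₂ refl) , ac , bc
third-corner _ (ab , bc , ac) (inj₁ refl) (inj₂ (inj₂ refl)) n = _ , inj₂ (inj₁ refl) , ab , bc ∘ sym
third-corner _ (ab , bc , ac) (inj₂ (inj₁ refl)) (inj₁ refl) n = _ , inj₂ (inj₂ refl) , bc , ac
third-corner _ _ (inj₂ (inj₁ refl)) (inj₂ (inj₁ refl)) n = contradiction refl n
third-corner _ (ab , bc , ac) (inj₂ (inj₁ refl)) (inj₂ (inj₂ refl)) n = _ , inj₁ refl , ab ∘ sym , ac ∘ sym
third-corner _ (ab , bc , ac) (inj₂ (inj₂ refl)) (inj₁ refl) n = _ , inj₂ (inj₁ refl) , bc ∘ sym , ab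
third-corner _ (ab , bc , ac) (inj₂ (inj₂ refl)) (inj₂ (inj₁ refl)) n = _ , inj₁ refl , ac ∘ sym , ab ∘ sym
third-corner _ _ (inj₂ (inj₂ refl)) (inj₂ (inj₂ refl)) n = contradiction refl n

∈⇒index : ∀ {F : Complex} {f} → f ∈ F → ∃ λ k → lookup F k ≡ f
∈⇒index p = Any.index p , sym (Any.lookup-index p)

_∈ᶠ?_ : ∀ x f → Dec (x ∈ᶠ f)
x ∈ᶠ? (a , b , c) = (x ≟ a) ⊎-dec (x ≟ b) ⊎-dec (x ≟ c)

-- LinkEdge unfolds to a Σ-type; a record keeps the complex and the vertices inferable.
record Triangle (F : Complex) (p q r : ℕ) : Set where
  constructor triangle
  field
    linkEdge : LinkEdge F p q r

triangle? : ∀ F p q r → Dec (Triangle F p q r)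
triangle? F p q r = map′ triangle Triangle.linkEdge
  (¬? (p ≟ q) ×-dec ¬? (p ≟ r) ×-dec ¬? (q ≟ r) ×-dec
   Fin.any? (λ k → (p ∈ᶠ? lookup F k) ×-dec (q ∈ᶠ? lookup F k) ×-dec (r ∈ᶠ? lookup F k)))

vertex-bound : ∀ F → ∃ λ n → ∀ {x} → VertexOf F x → x ℕ.< n
vertex-bound [] = 0 , λ ()
vertex-bound ((a , b , c) ∷ F) with vertex-bound F
... | n , below = m ⊔ n , bounded
  where
  m = suc (a ⊔ (b ⊔ c))
  head : ∀ {x} → x ≤ a ⊔ (b ⊔ c) → x ℕ.< m ⊔ n
  head h = <-≤-trans (s≤s h) (m≤m⊔n m n)
  bounded : ∀ {x} → VertexOf ((a , b , c) ∷ F) x → x ℕ.< m ⊔ n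
  bounded (fzero , inj₁ refl) = head (m≤m⊔n a _)
  bounded (fzero , inj₂ (inj₁ refl)) = head (≤-trans (m≤m⊔n b c) (m≤n⊔m a _))
  bounded (fzero , inj₂ (inj₂ refl)) = head (≤-trans (m≤n⊔m b c) (m≤n⊔m a _))
  bounded (fsuc k , h) = <-≤-trans (below (k , h)) (m≤n⊔m m n)

module _ {F : Complex} (T : IsTriangulation F) where
  open IsTriangulation T

  adj⇒edge : ∀ {x y} → Adj F x y → Edge (Triangle F) x y
  adj⇒edge (x≢y , k , hx , hy) with third-corner (lookup F k) (faceDistinct k) hx hy x≢y
  ... | r , hr , x≢r , y≢r = r , triangle (x≢y , x≢r , y≢r , k , hx , hy , hr)

  edge⇒adj : ∀ {x y} → Edge (Triangle F) x y → Adj F x y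
  edge⇒adj (r , triangle (x≢y , _ , _ , k , hx , hy , _)) = x≢y , k , hx , hy

  surface : Surface (Triangle F)
  surface = record
    { tri? = triangle? F
    ; distinct = λ (triangle (p≢q , _)) → p≢q
    ; swap₁₂ = λ (triangle (a , b , c , k , x , y , z)) → triangle (a ∘ sym , c , b , k , y , x , z)
    ; swap₂₃ = λ (triangle (a , b , c , k , x , y , z)) → triangle (b , a , c ∘ sym , k , x , z , y)
    ; bound = proj₁ (vertex-bound F)
    ; bounded = λ (triangle (_ , _ , _ , k , x , _)) → proj₂ (vertex-bound F) (k , x)
    ; opposite = opposite
    ; link = λ e f → reach (linkConnected _ _ _ (edge⇒adj e) (edge⇒adj f)) }
    where
    reach : ∀ {x y z} → Reach (LinkEdge F x) y z → Reach (Triangle F x) y z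
    reach here = here
    reach (there t ts) = there (triangle t) (reach ts)

    exhaust : ∀ k {p q r s} → Has F k p → Has F k q → Has F k r → p ≢ q → p ≢ r → q ≢ r → Has F k s → On p q r s
    exhaust k = corners-exhaust (lookup F k)

    opposite : ∀ {p q r} → Triangle F p q r →
      ∃ λ r′ → r′ ≢ r × Triangle F p q r′ × (∀ s → Triangle F p q s → s ≡ r ⊎ s ≡ r′)
    opposite {p} {q} {r} (triangle (p≢q , p≢r , q≢r , m , mp , mq , mr))
      with edgeTwoFaces p q (p≢q , m , mp , mq)
    ... | k , l , k≢l , kp , kq , lp , lq , only = by-face (only m mp mq)
      where
      build : ∀ l → m ≢ l → Has F l p → Has F l q → (∀ n → Has F n p → Has F n q → n ≡ m ⊎ n ≡ l) →
        ∃ λ r′ → r′ ≢ r × Triangle F p q r′ × (∀ s → Triangle F p q s → s ≡ r ⊎ s ≡ r′)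
      build l m≢l lp lq only with third-corner (lookup F l) (faceDistinct l) lp lq p≢q
      ... | r′ , lr′ , p≢r′ , q≢r′ = r′ , r′≢r , triangle (p≢q , p≢r′ , q≢r′ , l , lp , lq , lr′) , others
        where
        r′≢r : r′ ≢ r
        r′≢r refl = m≢l (facesDistinct m l λ x mx → included (exhaust m mp mq mr p≢q p≢r q≢r mx))
          where
          included : ∀ {x} → On p q r x → Has F l x
          included (inj₁ refl) = lp
          included (inj₂ (inj₁ refl)) = lq
          included (inj₂ (inj₂ refl)) = lr′
        same : ∀ n {r s} → Has F n p → Has F n q → Has F n r → p ≢ r → q ≢ r →
          p ≢ s → q ≢ s → Has F n s → s ≡ r
        same n np nq nr p≢r q≢r p≢s q≢s ns with exhaust n np nq nr p≢q p≢r q≢r ns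
        ... | inj₁ refl = contradiction refl p≢s
        ... | inj₂ (inj₁ refl) = contradiction refl q≢s
        ... | inj₂ (inj₂ e) = e
        others : ∀ s → Triangle F p q s → s ≡ r ⊎ s ≡ r′
        others s (triangle (_ , p≢s , q≢s , n , np , nq , ns)) with only n np nq
        ... | inj₁ refl = inj₁ (same n mp mq mr p≢r q≢r p≢s q≢s ns)
        ... | inj₂ refl = inj₂ (same n lp lq lr′ p≢r′ q≢r′ p≢s q≢s ns)
      by-face : m ≡ k ⊎ m ≡ l → _
      by-face (inj₁ refl) = build l k≢l lp lq only
      by-face (inj₂ refl) = build k (k≢l ∘ sym) kp kq (λ n np nq → Sum.swap (only n np nq))

  open Surface surface

  -- The third vertices of the two faces at ac are common neighbours, so they use up the two that
  -- contractibility allows.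
  contractible⇒facial : ∀ {a c b} → Adj F a c → Contractible F a c → Adj F a b → Adj F c b → Triangle F a c b
  contractible⇒facial {a} {c} {b} ac (b₁ , b₂ , _ , _ , _ , _ , _ , only) ab cb with adj⇒edge ac
  ... | r , t with opposite t
  ... | r′ , r′≢r , t′ , _
    with only r (edge⇒adj (edge₁₃ t)) (edge⇒adj (edge₂₃ t))
       | only r′ (edge⇒adj (edge₁₃ t′)) (edge⇒adj (edge₂₃ t′)) | only b ab cb
  ... | inj₁ refl | inj₁ refl | _ = contradiction refl r′≢r
  ... | inj₂ refl | inj₂ refl | _ = contradiction refl r′≢r
  ... | inj₁ refl | inj₂ refl | inj₁ refl = t
  ... | inj₁ refl | inj₂ refl | inj₂ refl = t′
  ... | inj₂ refl | inj₁ refl | inj₁ refl = t′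
  ... | inj₂ refl | inj₁ refl | inj₂ refl = t

  cycle⇒¬contractible : ∀ {x y z} → Cycle (Triangle F) x y z → ¬ Contractible F x y
  cycle⇒¬contractible (cycle xy xz yz n) h =
    n (contractible⇒facial (edge⇒adj xy) h (edge⇒adj xz) (edge⇒adj yz))

-- Contraction of face lists as a map of surfaces

renamed : ℕ → ℕ → ℕ → ℕ
renamed a c x = if x ≡ᵇ c then a else x

module _ {a c : ℕ} where

  renamed-c : renamed a c c ≡ a
  renamed-c with c ≡ᵇ c in e
  ... | true = refl
  ... | false = ⊥-elim (subst T e (≡⇒≡ᵇ c c refl))

  renamed-off : ∀ {x} → x ≢ c → renamed a c x ≡ x
  renamed-off {x} x≢c with x ≡ᵇ c in e
  ... | true = contradiction (≡ᵇ⇒≡ x c (subst T (sym e) _)) x≢c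
  ... | false = refl

  renamed-inj : ∀ {s t} → renamed a c s ≡ renamed a c t → s ≡ t ⊎ (s ≡ a × t ≡ c) ⊎ (s ≡ c × t ≡ a)
  renamed-inj {s} {t} e with s ≟ c | t ≟ c
  ... | yes refl | yes refl = inj₁ refl
  ... | yes refl | no t≢c = inj₂ (inj₂ (refl , trans (sym (renamed-off t≢c)) (trans (sym e) renamed-c)))
  ... | no s≢c | yes refl = inj₂ (inj₁ (trans (sym (renamed-off s≢c)) (trans e renamed-c) , refl))
  ... | no s≢c | no t≢c = inj₁ (trans (sym (renamed-off s≢c)) (trans e (renamed-off t≢c)))

renFace-∈⁺ : ∀ g f {x} → x ∈ᶠ f → g x ∈ᶠ renFace g f
renFace-∈⁺ g f (inj₁ refl) = inj₁ refl
renFace-∈⁺ g f (inj₂ (inj₁ refl)) = inj₂ (inj₁ refl)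
renFace-∈⁺ g f (inj₂ (inj₂ refl)) = inj₂ (inj₂ refl)

renFace-∈⁻ : ∀ g f {x} → x ∈ᶠ renFace g f → ∃ λ y → y ∈ᶠ f × x ≡ g y
renFace-∈⁻ g f (inj₁ e) = _ , inj₁ refl , e
renFace-∈⁻ g f (inj₂ (inj₁ e)) = _ , inj₂ (inj₁ refl) , e
renFace-∈⁻ g f (inj₂ (inj₂ e)) = _ , inj₂ (inj₂ refl) , e

hasᵇ⇒∈ᶠ : ∀ x f → hasᵇ x f ≡ true → x ∈ᶠ f
hasᵇ⇒∈ᶠ x (a , b , c) h with x ≡ᵇ a in ea | x ≡ᵇ b in eb | x ≡ᵇ c in ec
... | true | _ | _ = inj₁ (≡ᵇ⇒≡ x a (subst T (sym ea) _))
... | false | true | _ = inj₂ (inj₁ (≡ᵇ⇒≡ x b (subst T (sym eb) _)))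
... | false | false | true = inj₂ (inj₂ (≡ᵇ⇒≡ x c (subst T (sym ec) _)))

module _ {F : Complex} {a c : ℕ} where
  private
    φ = renamed a c
    G = contract F a c

  lift-face : ∀ k → ∃ λ l → lookup G k ≡ renFace φ (lookup F l)
  lift-face k with ∈-map⁻ (renFace φ) (∈-lookup {xs = G} k)
  ... | f , f∈ , e with ∈⇒index (proj₁ (∈-filter⁻ (T? ∘ _) {xs = F} f∈))
  ...   | l , refl = l , e

  lift-has : ∀ {k l x} → lookup G k ≡ renFace φ (lookup F l) → Has G k x → ∃ λ y → Has F l y × x ≡ φ y
  lift-has {k} {l} {x} e h = renFace-∈⁻ φ (lookup F l) (subst (x ∈ᶠ_) e h)

  lift-adj : ∀ {x y} → Adj G x y → ∃₂ λ x′ y′ → Adj F x′ y′ × x ≡ φ x′ × y ≡ φ y′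
  lift-adj (x≢y , k , hx , hy) with lift-face k
  ... | l , e with lift-has e hx | lift-has e hy
  ... | x′ , lx′ , refl | y′ , ly′ , refl = x′ , y′ , (x≢y ∘ cong φ , l , lx′ , ly′) , refl , refl

  lift-tri : ∀ {p q r} → Triangle G p q r → ∃ λ p′ → ∃ λ q′ → ∃ λ r′ →
    Triangle F p′ q′ r′ × φ p′ ≡ p × φ q′ ≡ q × φ r′ ≡ r
  lift-tri (triangle (p≢q , p≢r , q≢r , k , hp , hq , hr)) with lift-face k
  ... | l , e with lift-has e hp | lift-has e hq | lift-has e hr
  ... | p′ , lp , refl | q′ , lq , refl | r′ , lr , refl =
    p′ , q′ , r′ , triangle (p≢q ∘ cong φ , p≢r ∘ cong φ , q≢r ∘ cong φ , l , lp , lq , lr) , refl , refl , refl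

  -- A face is filtered out only if it contains both a and c, and then two of its corners would have
  -- the same image.
  push-tri : a ≢ c → ∀ {p q r} → Triangle F p q r → φ p ≢ φ q → φ p ≢ φ r → φ q ≢ φ r →
    Triangle G (φ p) (φ q) (φ r)
  push-tri a≢c {p} {q} {r} (triangle (p≢q , p≢r , q≢r , l , lp , lq , lr)) φp≢φq φp≢φr φq≢φr
    with ∈⇒index (∈-map⁺ (renFace φ) (∈-filter⁺ (T? ∘ _) (∈-lookup {xs = F} l) kept))
    where
    f = lookup F l
    merged : φ a ≡ φ c
    merged = trans (renamed-off a≢c) (sym (renamed-c {a} {c}))
    meet : On p q r a → On p q r c → ⊥
    meet (inj₁ refl) (inj₁ refl) = a≢c refl
    meet (inj₁ refl) (inj₂ (inj₁ refl)) = φp≢φq merged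
    meet (inj₁ refl) (inj₂ (inj₂ refl)) = φp≢φr merged
    meet (inj₂ (inj₁ refl)) (inj₁ refl) = φp≢φq (sym merged)
    meet (inj₂ (inj₁ refl)) (inj₂ (inj₁ refl)) = a≢c refl
    meet (inj₂ (inj₁ refl)) (inj₂ (inj₂ refl)) = φq≢φr merged
    meet (inj₂ (inj₂ refl)) (inj₁ refl) = φp≢φr (sym merged)
    meet (inj₂ (inj₂ refl)) (inj₂ (inj₁ refl)) = φq≢φr (sym merged)
    meet (inj₂ (inj₂ refl)) (inj₂ (inj₂ refl)) = a≢c refl
    exhaust : ∀ {s} → s ∈ᶠ f → On p q r s
    exhaust = corners-exhaust f lp lq lr p≢q p≢r q≢r
    kept : T (not (hasᵇ a f ∧ hasᵇ c f))
    kept with hasᵇ a f in ea | hasᵇ c f in ec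
    ... | false | _ = _
    ... | true | false = _
    ... | true | true = meet (exhaust (hasᵇ⇒∈ᶠ a f ea)) (exhaust (hasᵇ⇒∈ᶠ c f ec))
  ... | k , e = triangle (φp≢φq , φp≢φr , φq≢φr , k , image lp , image lq , image lr)
    where
    image : ∀ {x} → Has F l x → Has G k (φ x)
    image {x} h = subst (φ x ∈ᶠ_) (sym e) (renFace-∈⁺ φ (lookup F l) h)

  contraction-merges : IsTriangulation F → Adj F a c → Contractible F a c →
    Merges (Triangle F) (Triangle G) φ a c
  contraction-merges T ac h = record
    { ac = adj⇒edge T ac
    ; merge = trans (renamed-off (proj₁ ac)) (sym (renamed-c {a} {c}))
    ; inj = renamed-inj
    ; facial = λ e f → contractible⇒facial T ac h (edge⇒adj T e) (edge⇒adj T f)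
    ; push = push-tri (proj₁ ac)
    ; lift = lift-tri }

-- Discs in a cut and capped triangulation

count : ℕ → (ℕ → Bool) → ℕ
count zero f = 0
count (suc n) f = if f n then suc (count n f) else count n f

count-mono-≤ : ∀ n {f g} → (∀ {i} → f i ≡ true → g i ≡ true) → count n f ≤ count n g
count-mono-≤ zero h = z≤n
count-mono-≤ (suc n) {f} {g} h with f n in fn | g n in gn
... | false | false = count-mono-≤ n h
... | false | true = m≤n⇒m≤1+n (count-mono-≤ n h)
... | true | true = s≤s (count-mono-≤ n h)
... | true | false = contradiction (trans (sym gn) (h fn)) λ ()

count-mono-< : ∀ n {f g p} → p ℕ.< n → (∀ {i} → f i ≡ true → g i ≡ true) →
  f p ≡ false → g p ≡ true → count n f ℕ.< count n g
count-mono-< (suc n) {f} {g} {p} p<1+n h fp gp with m<1+n⇒m<n∨m≡n p<1+n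
... | inj₂ refl rewrite fp | gp = s≤s (count-mono-≤ n h)
... | inj₁ p<n with f n in fn | g n in gn
...   | false | false = count-mono-< n p<n h fp gp
...   | false | true = m≤n⇒m≤1+n (count-mono-< n p<n h fp gp)
...   | true | true = s≤s (count-mono-< n p<n h fp gp)
...   | true | false = contradiction (trans (sym gn) (h fn)) λ ()

xor-cancelʳ : ∀ a b c → a xor c ≡ b xor c → a ≡ b
xor-cancelʳ false false c e = refl
xor-cancelʳ true true c e = refl
xor-cancelʳ false true false ()
xor-cancelʳ false true true ()
xor-cancelʳ true false false ()
xor-cancelʳ true false true ()

-- What the cut/cap operation on an irreducible triangulation leaves of irreducibility.
record Twinned (Tri : Triangles) (Frame : ℕ → Set) (Twin : ℕ → ℕ → Set) : Set where
  field
    twin-sym     : ∀ {h h′} → Twin h h′ → Twin h′ h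
    twin-frame   : ∀ {h h′} → Twin h h′ → Frame h
    twin-≢       : ∀ {h h′} → Twin h h′ → h ≢ h′
    twin-no-edge : ∀ {h h′} → Twin h h′ → ¬ Edge Tri h h′
    third        : ∀ {p x} → ¬ Frame p → Edge Tri p x →
      ∃ λ m → Edge Tri p m × m ≢ x × ¬ Tri p x m ×
        (Edge Tri x m ⊎ (∃ λ x′ → Twin x x′ × Edge Tri m x′) ⊎ (∃ λ m′ → Twin m m′ × Edge Tri x m′))

module _ {Tri : Triangles} (S : Surface Tri) {Frame : ℕ → Set} {Twin : ℕ → ℕ → Set}
         (twinned : Twinned Tri Frame Twin) where
  open Surface S
  open Separation S
  open Twinned twinned

  module Shrink {x y z} (C : Cycle Tri x y z) (D : Disc Tri Frame x y z) where
    open Cycle C renaming (edge₁₂ to xy; edge₁₃ to xz; edge₂₃ to yz)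
    open Disc D
    open Separates separates

    on⇒outside : ∀ {s} → inside s ≡ true → ¬ On x y z s
    on⇒outside h on = contradiction (trans (sym h) (normal on)) λ ()

    inside⇒off : ∀ {s} → inside s ≡ true → Off x y z s
    inside⇒off {s} h with on? x y z s
    ... | inj₁ on = contradiction on (on⇒outside h)
    ... | inj₂ off = off

    neighbour : ∀ {p s} → inside p ≡ true → Edge Tri p s → inside s ≡ true ⊎ On x y z s
    neighbour {p} {s} h e with on? x y z s
    ... | inj₁ on = inj₂ on
    ... | inj₂ off = inj₁ (trans (sym (const e (inside⇒off h) off)) h)

    inner-third : ∃ λ p → Tri x y p × inside p ≡ true
    inner-third with inside (proj₁ xy) in i₁ | opposite (proj₂ xy)
    ... | true | _ = _ , proj₂ xy , i₁
    ... | false | r′ , r′≢r , t′ , _ with inside r′ in i₂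
    ...   | true = r′ , t′ , i₂
    ...   | false = contradiction (trans i₁ (sym i₂)) (differs₁₂ (proj₂ xy) t′ (r′≢r ∘ sym))

    p = proj₁ inner-third
    xyp = proj₁ (proj₂ inner-third)
    p-inside = proj₂ (proj₂ inner-third)
    px = edge-sym (edge₁₃ xyp)

    -- The 3-cycle at px cannot have been opened. m lies in the closed disc, and twins are frame
    -- vertices, so none is inside. If m lies on the boundary, it is adjacent to x anyway. If m is
    -- inside, a twin of x adjacent to m would be y or z, giving an edge between twins.
    inner-cycle : ∃ λ m → Cycle Tri p x m
    inner-cycle with third (off-frame p-inside) px
    ... | m , pm , m≢x , ¬pxm , alternatives = m , cycle px pm (xm alternatives) ¬pxm
      where
      on-edge : On x y z m → Edge Tri x m
      on-edge (inj₁ e) = contradiction e m≢x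
      on-edge (inj₂ (inj₁ refl)) = xy
      on-edge (inj₂ (inj₂ refl)) = xz
      xm : _ → Edge Tri x m
      xm (inj₁ e) = e
      xm (inj₂ (inj₂ (m′ , twin , _))) with neighbour p-inside pm
      ... | inj₁ h = contradiction (twin-frame twin) (off-frame h)
      ... | inj₂ on = on-edge on
      xm (inj₂ (inj₁ (x′ , twin , mx′))) with neighbour p-inside pm
      ... | inj₂ on = on-edge on
      ... | inj₁ h with neighbour h mx′
      ...   | inj₁ h′ = contradiction (twin-frame (twin-sym twin)) (off-frame h′)
      ...   | inj₂ (inj₁ refl) = contradiction refl (twin-≢ twin)
      ...   | inj₂ (inj₂ (inj₁ refl)) = contradiction xy (twin-no-edge twin)
      ...   | inj₂ (inj₂ (inj₂ refl)) = contradiction xz (twin-no-edge twin)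

    m = proj₁ inner-cycle
    C′ = proj₂ inner-cycle

    m-in : inside m ≡ true ⊎ On x y z m
    m-in = neighbour p-inside (Cycle.edge₁₃ C′)

    separation : Separable Tri p x m
    separation = separable (inj₁ p-inside) (inj₂ (inj₁ refl)) m-in C′

    K = proj₁ separation
    module K = Separates (proj₂ separation)

    -- y marks the outer side of pxm. It differs from m because pxy is a face and pxm is not.
    y-off : Off p x m y
    y-off = (λ e → on⇒outside p-inside (inj₂ (inj₁ (sym e)))) , edge-≢ xy ∘ sym ,
            λ e → Cycle.nonfacial C′ (subst (Tri p x) e (swap₁₂ (swap₂₃ xyp)))

    boundary-off : ∀ {s} → Off p x m s → On x y z s → K s ≡ K y
    boundary-off (_ , s≢x , _) (inj₁ e) = contradiction e s≢x
    boundary-off _ (inj₂ (inj₁ refl)) = refl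
    boundary-off off (inj₂ (inj₂ refl)) = sym (K.const yz y-off off)

    -- The side of pxm away from y, which then also misses z.
    inside′ : ℕ → Bool
    inside′ s with on? p x m s
    ... | inj₁ _ = false
    ... | inj₂ _ = inside s ∧ (K s xor K y)

    inside′-on : ∀ {s} → On p x m s → inside′ s ≡ false
    inside′-on {s} on with on? p x m s
    ... | inj₁ _ = refl
    ... | inj₂ off = contradiction off (on-off on)

    inside′-off : ∀ {s} → Off p x m s → inside′ s ≡ inside s ∧ (K s xor K y)
    inside′-off {s} off with on? p x m s
    ... | inj₁ on = contradiction off (on-off on)
    ... | inj₂ _ = refl

    inside′⊆inside : ∀ {s} → inside′ s ≡ true → inside s ≡ true
    inside′⊆inside {s} h with on? p x m s
    ... | inj₂ _ = ∧-conicalˡ (inside s) _ h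

    -- Vertices of xyz off the new cycle have the value of y, so an edge on the far side avoids xyz
    -- and the constancy of `inside` applies.
    inside-const : ∀ {s t} → Edge Tri s t → Off p x m s → Off p x m t → K s xor K y ≡ true → inside s ≡ inside t
    inside-const {s} {t} e s-off t-off far = const e (off s-off far) (off t-off (trans (cong (_xor K y) (sym (K.const e s-off t-off))) far))
      where
      off : ∀ {s} → Off p x m s → K s xor K y ≡ true → Off x y z s
      off {s} s-off far with on? x y z s
      ... | inj₂ o = o
      ... | inj₁ on = contradiction
            (trans (sym far) (trans (cong (_xor K y) (boundary-off s-off on)) (xor-same (K y)))) λ ()

    const′ : ∀ {s t} → Edge Tri s t → Off p x m s → Off p x m t → inside′ s ≡ inside′ t
    const′ {s} {t} e s-off t-off = trans (inside′-off s-off) (trans (by-cases (K s xor K y) refl) (sym (inside′-off t-off)))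
      where
      by-cases : ∀ b → K s xor K y ≡ b → inside s ∧ (K s xor K y) ≡ inside t ∧ (K t xor K y)
      by-cases true far = cong₂ _∧_ (inside-const e s-off t-off far) (cong (_xor K y) (K.const e s-off t-off))
      by-cases false near = trans (vanish (inside s) near)
        (sym (vanish (inside t) (trans (cong (_xor K y) (sym (K.const e s-off t-off))) near)))
        where
        vanish : ∀ a {b} → b ≡ false → a ∧ b ≡ false
        vanish false _ = refl
        vanish true e = e

    -- All neighbours of p lie in the closed disc, and those on its boundary have the value of y.
    -- Intersecting with `inside` therefore changes nothing beside px, and the change of `K` across
    -- px is kept.
    inside′-third : ∀ {α} → Tri p x α → inside′ α ≡ K α xor K y
    inside′-third {α} t = trans (inside′-off off) (by-cases (neighbour p-inside (edge₁₃ t)))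
      where
      off : Off p x m α
      off = distinct₁₃ t ∘ sym , distinct₂₃ t ∘ sym , λ { refl → Cycle.nonfacial C′ t }
      by-cases : inside α ≡ true ⊎ On x y z α → inside α ∧ (K α xor K y) ≡ K α xor K y
      by-cases (inj₁ h) rewrite h = refl
      by-cases (inj₂ on) rewrite normal on | boundary-off off on = sym (xor-same (K y))

    disc′ : Disc Tri Frame p x m
    disc′ = record
      { inside = inside′
      ; normal = inside′-on
      ; off-frame = off-frame ∘ inside′⊆inside
      ; separates = separates-from-edge C′ const′ λ {α} {β} t u α≢β e →
          K.differs₁₂ t u α≢β (xor-cancelʳ (K α) (K β) (K y)
            (trans (sym (inside′-third t)) (trans e (inside′-third u))))
      ; separable = λ a b c → separable (widen a) (widen b) (widen c) }
      where
      widen : ∀ {s} → inside′ s ≡ true ⊎ On p x m s → inside s ≡ true ⊎ On x y z s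
      widen (inj₁ h) = inj₁ (inside′⊆inside h)
      widen (inj₂ (inj₁ refl)) = inj₁ p-inside
      widen (inj₂ (inj₂ (inj₁ refl))) = inj₂ (inj₁ refl)
      widen (inj₂ (inj₂ (inj₂ refl))) = m-in

    -- p was inside and is now on the boundary.
    smaller : count bound inside′ ℕ.< count bound inside
    smaller = count-mono-< bound (bounded (proj₂ px)) inside′⊆inside (inside′-on (inj₁ refl)) p-inside

  no-disc : ∀ {x y z} → Cycle Tri x y z → ¬ Disc Tri Frame x y z
  no-disc C D = go C D (<-wellFounded _)
    where
    go : ∀ {x y z} → Cycle Tri x y z → (D : Disc Tri Frame x y z) →
      Acc ℕ._<_ (count bound (Disc.inside D)) → ⊥
    go C D (acc rec) = go C′ disc′ (rec smaller)
      where open Shrink C D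

-- The faces of the cut and capped triangulation

lookup-injective : ∀ {xs : List ℕ} → Unique xs → ∀ i j → lookup xs i ≡ lookup xs j → i ≡ j
lookup-injective (_ ∷ _) fzero fzero e = refl
lookup-injective (x∉ ∷ _) fzero (fsuc j) e = contradiction e (All.lookup x∉ (∈-lookup j))
lookup-injective (x∉ ∷ _) (fsuc i) fzero e = contradiction (sym e) (All.lookup x∉ (∈-lookup i))
lookup-injective (_ ∷ unique) (fsuc i) (fsuc j) e = cong fsuc (lookup-injective unique i j e)

adj? : ∀ F x y → Dec (Adj F x y)
adj? F x y = ¬? (x ≟ y) ×-dec Fin.any? (λ k → (x ∈ᶠ? lookup F k) ×-dec (y ∈ᶠ? lookup F k))

-- A bounded search either finds a nonfacial common neighbour or shows that all common neighbours
-- are third vertices of faces at xy; there are exactly two of these, so xy would be contractible.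
noncontractible⇒cycle : ∀ {F} → IsTriangulation F → ∀ {x y} → Adj F x y → ¬ Contractible F x y →
  ∃ (Cycle (Triangle F) x y)
noncontractible⇒cycle {F} TF {x} {y} xy n =
  by-search (anyUpTo? (λ z → adj? F x z ×-dec adj? F y z ×-dec ¬? (triangle? F x y z)) bound)
  where
  open Surface (surface TF)
  by-search : Dec (∃ λ z → z ℕ.< bound × Adj F x z × Adj F y z × ¬ Triangle F x y z) → ∃ (Cycle (Triangle F) x y)
  by-search (yes (z , _ , xz , yz , nonfacial)) =
    z , cycle (adj⇒edge TF xy) (adj⇒edge TF xz) (adj⇒edge TF yz) nonfacial
  by-search (no none) with adj⇒edge TF xy
  ... | r , t with opposite t
  ... | r′ , r′≢r , t′ , only = contradiction
    (r , r′ , r′≢r ∘ sym , edge⇒adj TF (edge₁₃ t) , edge⇒adj TF (edge₂₃ t) ,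
      edge⇒adj TF (edge₁₃ t′) , edge⇒adj TF (edge₂₃ t′) ,
      λ b xb yb → only b (decidable-stable (triangle? F x y b) λ nonfacial →
        none (b , bounded (swap₁₂ (proj₂ (adj⇒edge TF xb))) , xb , yb , nonfacial))) n

module Copies (u v : Fin 3 → ℕ) where
  cp : Fin 3 → Bool → ℕ
  cp i b = if b then u i else v i

  module _ {F : Complex} {t : ℕ} (fresh : Fresh F u v t) where
    private
      names : List ℕ
      names = t ∷ u i0 ∷ u i1 ∷ u i2 ∷ v i0 ∷ v i1 ∷ v i2 ∷ []

      -- Position of a copy in `names`; `read` inverts it, so that distinctness of the names makes
      -- `cp` injective without comparing them pairwise.
      place : Fin 3 → Bool → Fin 7
      place i true = fsuc (i ↑ˡ 3)
      place i false = fsuc (fsuc (fsuc (fsuc i)))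

      read : Fin 7 → Maybe (Fin 3 × Bool)
      read fzero = nothing
      read (fsuc fzero) = just (i0 , true)
      read (fsuc (fsuc fzero)) = just (i1 , true)
      read (fsuc (fsuc (fsuc fzero))) = just (i2 , true)
      read (fsuc (fsuc (fsuc (fsuc i)))) = just (i , false)

      read-place : ∀ i b → read (place i b) ≡ just (i , b)
      read-place fzero true = refl
      read-place (fsuc fzero) true = refl
      read-place (fsuc (fsuc fzero)) true = refl
      read-place i false = refl

      cp-place : ∀ i b → cp i b ≡ lookup names (place i b)
      cp-place fzero true = refl
      cp-place (fsuc fzero) true = refl
      cp-place (fsuc (fsuc fzero)) true = refl
      cp-place fzero false = refl
      cp-place (fsuc fzero) false = refl
      cp-place (fsuc (fsuc fzero)) false = refl

    cp-injective : ∀ {i j b c} → cp i b ≡ cp j c → i ≡ j × b ≡ c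
    cp-injective {i} {j} {b} {c} e = ,-injective (just-injective (trans (sym (read-place i b))
      (trans (cong read (lookup-injective (proj₁ fresh) _ _
        (trans (sym (cp-place i b)) (trans e (cp-place j c))))) (read-place j c))))

    cp≢t : ∀ {i b} → cp i b ≢ t
    cp≢t {i} {b} e with trans (sym (read-place i b))
      (cong read (lookup-injective (proj₁ fresh) (place i b) fzero (trans (sym (cp-place i b)) e)))
    ... | ()

    vertex≢cp : ∀ {x i b} → VertexOf F x → x ≢ cp i b
    vertex≢cp {x} {i} {b} h e = proj₂ fresh x h
      (subst (_∈ names) (trans (sym (cp-place i b)) (sym e)) (∈-lookup (place i b)))

    vertex≢t : ∀ {x} → VertexOf F x → x ≢ t
    vertex≢t {x} h e = proj₂ fresh x h (subst (_∈ names) (sym e) (∈-lookup fzero))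

-- τ i j b is the side of w j met by an edge from the copy of w i on side b to a copy of w j.
record CapShape (F : Complex) (w u v : Fin 3 → ℕ) (t : ℕ) (s : Sides F) (Fr : Complex) : Set where
  open Copies u v
  field
    τ          : Fin 3 → Fin 3 → Bool → Bool
    τ-not      : ∀ i j b → τ i j (not b) ≡ not (τ i j b)
    naming     : ∀ {i j k} → i ≢ j → Has F k (w i) → Has F k (w j) → s k j ≡ τ i j (s k i)
    cap-edge   : ∀ {i j} b → i ≢ j → Adj Fr (cp i b) (cp j (τ i j b))
    cap-edge⁻  : ∀ {x y} → Adj Fr x y →
      x ≡ t ⊎ y ≡ t ⊎ (∃ λ i → ∃ λ j → ∃ λ b → i ≢ j × x ≡ cp i b × y ≡ cp j (τ i j b))
    cap-vertex : ∀ {x} → VertexOf Fr x → x ≡ t ⊎ (∃₂ λ i b → x ≡ cp i b)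

-- R k x is the copy of x at face k.
record IsCutCap (F : Complex) (w u v : Fin 3 → ℕ) (s : Sides F) (Fr T′ : Complex) : Set where
  open Copies u v
  field
    R        : Idx F → ℕ → ℕ
    R-off    : ∀ {k x} → ¬ InC w x → R k x ≡ x
    R-w      : ∀ k i → R k (w i) ≡ cp i (s k i)
    cut-face : ∀ k → ∃ λ k′ → lookup T′ k′ ≡ renFace (R k) (lookup F k)
    cap-face : ∀ l → ∃ λ k′ → lookup T′ k′ ≡ lookup Fr l
    origin   : ∀ k′ → (∃ λ k → lookup T′ k′ ≡ renFace (R k) (lookup F k)) ⊎ (∃ λ l → lookup T′ k′ ≡ lookup Fr l)

module _ {F : Complex} {w : Fin 3 → ℕ} (w-injective : ∀ i j → w i ≡ w j → i ≡ j) where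

  private
    w-≢ : ∀ {i j} → i ≢ j → w i ≢ w j
    w-≢ i≢j e = i≢j (w-injective _ _ e)

  isCutCap : ∀ u v s Fr → IsCutCap F w u v s Fr (cutFaces F w u v s ++ Fr)
  isCutCap u v s Fr = record
    { R = R ; R-off = R-off ; R-w = R-w
    ; cut-face = λ k → ∈⇒index (∈-++⁺ˡ (∈-tabulate⁺ k))
    ; cap-face = λ l → ∈⇒index (∈-++⁺ʳ (cutFaces F w u v s) (∈-lookup l))
    ; origin = origin }
    where
    open Copies u v
    T′ = cutFaces F w u v s ++ Fr
    R : Idx F → ℕ → ℕ
    R k = renV w u v (s k)
    R-off : ∀ {k x} → ¬ InC w x → R k x ≡ x
    R-off {k} {x} x∉w
      rewrite dec-false (x ≟ w i0) (λ e → x∉w (i0 , e))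
            | dec-false (x ≟ w i1) (λ e → x∉w (i1 , e))
            | dec-false (x ≟ w i2) (λ e → x∉w (i2 , e)) = refl
    R-w : ∀ k i → R k (w i) ≡ cp i (s k i)
    R-w k fzero rewrite dec-true (w i0 ≟ w i0) refl = refl
    R-w k (fsuc fzero)
      rewrite dec-false (w i1 ≟ w i0) (w-≢ λ ()) | dec-true (w i1 ≟ w i1) refl = refl
    R-w k (fsuc (fsuc fzero))
      rewrite dec-false (w i2 ≟ w i0) (w-≢ λ ()) | dec-false (w i2 ≟ w i1) (w-≢ λ ())
            | dec-true (w i2 ≟ w i2) refl = refl
    origin : ∀ k′ → (∃ λ k → lookup T′ k′ ≡ renFace (R k) (lookup F k)) ⊎ (∃ λ l → lookup T′ k′ ≡ lookup Fr l)
    origin k′ with ∈-++⁻ (cutFaces F w u v s) (∈-lookup {xs = T′} k′)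
    ... | inj₁ f∈ = inj₁ (∈-tabulate⁻ f∈)
    ... | inj₂ f∈ with ∈⇒index f∈
    ...   | l , e = inj₂ (l , sym e)

module CutCapped {F : Complex} {w u v : Fin 3 → ℕ} {t : ℕ} {s : Sides F} {Fr T′ : Complex}
  (TF : IsTriangulation F) (irreducible : Irreducible F)
  (w-injective : ∀ i j → w i ≡ w j → i ≡ j)
  (fresh : Fresh F u v t) (local : LocalSides F w s) (shape : CapShape F w u v t s Fr)
  (cut-cap : IsCutCap F w u v s Fr T′) (TT′ : IsTriangulation T′) where

  open Copies u v
  open CapShape shape
  open IsCutCap cut-cap

  Frame : ℕ → Set
  Frame = FrameVertex Fr

  Tri′ : Triangles
  Tri′ = Triangle T′

  open Surface (surface TT′)
  open Separation (surface TT′)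

  R-view : ∀ k x → (¬ InC w x × R k x ≡ x) ⊎ (∃ λ i → x ≡ w i × R k x ≡ cp i (s k i))
  R-view k x with Fin.any? (λ i → x ≟ w i)
  ... | yes (i , refl) = inj₂ (i , refl , R-w k i)
  ... | no x∉w = inj₁ (x∉w , R-off x∉w)

  vertex-unframed : ∀ {x} → VertexOf F x → ¬ Frame x
  vertex-unframed h f with cap-vertex f
  ... | inj₁ e = vertex≢t {F} fresh h e
  ... | inj₂ (_ , _ , e) = vertex≢cp {F} fresh h e

  another : ∀ (i : Fin 3) → ∃ λ j → i ≢ j
  another fzero = i1 , λ ()
  another (fsuc i) = i0 , λ ()

  cp-frame : ∀ i b → Frame (cp i b)
  cp-frame i b with cap-edge b (proj₂ (another i))
  ... | _ , k , h , _ = k , h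

  R-twin : ∀ {k l x y} → Has F k x → Has F l y → R k x ≡ R l y → x ≡ y
  R-twin {k} {l} {x} {y} hx hy e with R-view k x | R-view l y
  ... | inj₁ (_ , ex) | inj₁ (_ , ey) = trans (sym ex) (trans e ey)
  ... | inj₁ (_ , ex) | inj₂ (j , _ , ey) =
        contradiction (trans (sym ex) (trans e ey)) (vertex≢cp {F} fresh (k , hx))
  ... | inj₂ (i , _ , ex) | inj₁ (_ , ey) =
        contradiction (trans (sym ey) (trans (sym e) ex)) (vertex≢cp {F} fresh (l , hy))
  ... | inj₂ (i , refl , ex) | inj₂ (j , refl , ey) =
        cong w (proj₁ (cp-injective {F} fresh (trans (sym ex) (trans e ey))))

  R-copy : ∀ {k x i b} → Has F k x → cp i b ≡ R k x → x ≡ w i × b ≡ s k i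
  R-copy {k} {x} hx e with R-view k x
  ... | inj₁ (_ , ex) = contradiction (trans (sym ex) (sym e)) (vertex≢cp {F} fresh (k , hx))
  ... | inj₂ (i , refl , ex) with cp-injective {F} fresh (trans e ex)
  ...   | refl , refl = refl , refl

  origin-has : ∀ {k k′ x} → lookup T′ k′ ≡ renFace (R k) (lookup F k) → Has T′ k′ x →
    ∃ λ x₀ → Has F k x₀ × x ≡ R k x₀
  origin-has {x = x} e h = renFace-∈⁻ _ _ (subst (x ∈ᶠ_) e h)

  adj⁻ : ∀ {x y} → Adj T′ x y → Adj Fr x y ⊎
    (∃ λ k → ∃₂ λ x₀ y₀ → Has F k x₀ × Has F k y₀ × x₀ ≢ y₀ × x ≡ R k x₀ × y ≡ R k y₀)
  adj⁻ {x} {y} (x≢y , k′ , hx , hy) with origin k′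
  ... | inj₂ (l , e) = inj₁ (x≢y , l , subst (x ∈ᶠ_) e hx , subst (y ∈ᶠ_) e hy)
  ... | inj₁ (k , e) with origin-has e hx | origin-has e hy
  ...   | x₀ , hx₀ , refl | y₀ , hy₀ , refl =
          inj₂ (k , x₀ , y₀ , hx₀ , hy₀ , (λ { refl → x≢y refl }) , refl , refl)

  adj⁺ : ∀ {k x y} → Has F k x → Has F k y → x ≢ y → Adj T′ (R k x) (R k y)
  adj⁺ {k} {x} {y} hx hy x≢y with cut-face k
  ... | k′ , e = x≢y ∘ R-twin hx hy , k′ ,
        subst (R k x ∈ᶠ_) (sym e) (renFace-∈⁺ (R k) (lookup F k) hx) ,
        subst (R k y ∈ᶠ_) (sym e) (renFace-∈⁺ (R k) (lookup F k) hy)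

  cap⁺ : ∀ {x y} → Adj Fr x y → Adj T′ x y
  cap⁺ {x} {y} (x≢y , l , hx , hy) with cap-face l
  ... | k′ , e = x≢y , k′ , subst (x ∈ᶠ_) (sym e) hx , subst (y ∈ᶠ_) (sym e) hy

  cut-vertex : ∀ {k p p₀} → ¬ Frame p → p ≡ R k p₀ → ¬ InC w p × p₀ ≡ p
  cut-vertex {k} {p₀ = p₀} ¬f e with R-view k p₀
  ... | inj₁ (p₀∉w , e′) = subst (¬_ ∘ InC w) p₀≡p p₀∉w , p₀≡p
    where p₀≡p = trans (sym e′) (sym e)
  ... | inj₂ (i , _ , e′) = contradiction (subst Frame (sym (trans e e′)) (cp-frame i _)) ¬f

  interior-adj⁻ : ∀ {p x} → ¬ Frame p → Adj T′ p x →
    ¬ InC w p × (∃₂ λ k x₀ → Has F k p × Has F k x₀ × p ≢ x₀ × x ≡ R k x₀)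
  interior-adj⁻ ¬f px with adj⁻ px
  ... | inj₁ (_ , l , hp , _) = contradiction (l , hp) ¬f
  ... | inj₂ (k , p₀ , x₀ , hp , hx , n , ep , ex) with cut-vertex {k} {p₀ = p₀} ¬f ep
  ...   | p∉w , refl = p∉w , k , x₀ , hp , hx , n , ex

  interior-tri⁻ : ∀ {p k l x m} → ¬ Frame p → Has F k x → Has F l m → Tri′ p (R k x) (R l m) → Triangle F p x m
  interior-tri⁻ {p} {k} {l} {x} {m} ¬f hx hm (triangle (a , b , c , k′ , hp′ , hx′ , hm′)) with origin k′
  ... | inj₂ (l′ , e) = contradiction (l′ , subst (p ∈ᶠ_) e hp′) ¬f
  ... | inj₁ (j , e) with origin-has e hp′ | origin-has e hx′ | origin-has e hm′
  ... | p₀ , hp , ep | x₀ , hx₀ , ex | m₀ , hm₀ , em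
    with cut-vertex {j} {p₀ = p₀} ¬f ep | R-twin {k} {j} hx hx₀ ex | R-twin {l} {j} hm hm₀ em
  ... | p∉w , refl | refl | refl =
    triangle ((λ { refl → a (trans ep (sym ex)) }) , (λ { refl → b (trans ep (sym em)) }) ,
      (λ { refl → c (trans ex (sym em)) }) , j , hp , hx₀ , hm₀)

  -- Cap faces and cut faces obey the same rule: the former through `cap-edge⁻`, the latter because
  -- `naming` fixes the side of one end by that of the other.
  copies-adj : ∀ {i j b c} → Adj T′ (cp i b) (cp j c) → i ≢ j × c ≡ τ i j b
  copies-adj xy with adj⁻ xy
  ... | inj₁ cap with cap-edge⁻ cap
  ...   | inj₁ e = contradiction e (cp≢t {F} fresh)
  ...   | inj₂ (inj₁ e) = contradiction e (cp≢t {F} fresh)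
  ...   | inj₂ (inj₂ (i , j , b , i≢j , ex , ey)) with cp-injective {F} fresh ex | cp-injective {F} fresh ey
  ...     | refl , refl | refl , e = i≢j , e
  copies-adj xy | inj₂ (k , x₀ , y₀ , hx , hy , n , ex , ey) with R-copy hx ex | R-copy hy ey
  ... | refl , refl | refl , refl = n ∘ cong w , naming (n ∘ cong w) hx hy

  -- An edge of a cut face with both ends on the frame is a copy of an edge of the 3-cycle w, and
  -- `naming` places it on a cap. So the frame has no chords.
  frame-edge⊎interior : ∀ {x y} → Adj T′ x y → FrameEdge Fr x y ⊎ ¬ Frame x ⊎ ¬ Frame y
  frame-edge⊎interior xy with adj⁻ xy
  ... | inj₁ cap = inj₁ cap
  ... | inj₂ (k , x₀ , y₀ , hx , hy , n , refl , refl) with R-view k x₀ | R-view k y₀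
  ...   | inj₁ (_ , ex) | _ = inj₂ (inj₁ (subst (¬_ ∘ Frame) (sym ex) (vertex-unframed (k , hx))))
  ...   | inj₂ _ | inj₁ (_ , ey) = inj₂ (inj₂ (subst (¬_ ∘ Frame) (sym ey) (vertex-unframed (k , hy))))
  ...   | inj₂ (i , refl , ex) | inj₂ (j , refl , ey) =
          inj₁ (subst₂ (Adj Fr) (sym ex) (trans (cong (cp j) (sym (naming (n ∘ cong w) hx hy))) (sym ey))
            (cap-edge (s k i) (n ∘ cong w)))

  Twin : ℕ → ℕ → Set
  Twin h h′ = ∃₂ λ i b → h ≡ cp i b × h′ ≡ cp i (not b)

  -- The corners at w i of the two faces on an edge from w i to a vertex off the 3-cycle lie on the
  -- same side, so such a vertex sees a single copy.
  no-common-interior : ∀ {n i b} → ¬ Frame n → Adj T′ n (cp i b) → ¬ Adj T′ n (cp i (not b))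
  no-common-interior ¬f e e′ with interior-adj⁻ ¬f e | interior-adj⁻ ¬f e′
  ... | n∉w , k , x , kn , kx , _ , ex | _ , l , y , ln , ly , _ , ey with R-copy kx ex | R-copy ly ey
  ... | refl , sk | refl , sl = not-¬ refl (trans sk (trans (proj₁ local _ k l _ n∉w kx kn ly ln) (sym sl)))

  -- The interior neighbour p excludes the cap vertex t, which in the one-sided case is adjacent to
  -- all copies. What remains for n is an interior vertex or a copy of some w j, and τ lets the
  -- latter meet only one copy of w i.
  no-common-neighbour : ∀ {p n i b} → ¬ Frame p → Adj T′ p n → Adj T′ n (cp i b) → ¬ Adj T′ n (cp i (not b))
  no-common-neighbour ¬f pn e e′ with interior-adj⁻ ¬f pn
  ... | _ , k , n₀ , _ , hn , _ , refl with R-view k n₀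
  ...   | inj₁ (_ , en) = no-common-interior (subst (¬_ ∘ Frame) (sym en) (vertex-unframed (k , hn))) e e′
  ...   | inj₂ (j , _ , en) rewrite en =
          not-¬ refl (trans (proj₂ (copies-adj e)) (sym (proj₂ (copies-adj e′))))

  same-or-twin : ∀ k l x → R k x ≡ R l x ⊎ Twin (R k x) (R l x)
  same-or-twin k l x with R-view k x | R-view l x
  ... | inj₁ (_ , e) | inj₁ (_ , e′) = inj₁ (trans e (sym e′))
  ... | inj₁ (x∉w , _) | inj₂ (i , e , _) = contradiction (i , e) x∉w
  ... | inj₂ (i , e , _) | inj₁ (x∉w , _) = contradiction (i , e) x∉w
  ... | inj₂ (i , refl , e) | inj₂ (j , ij , e′) with w-injective _ _ ij
  ...   | refl with s k i Bool.≟ s l i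
  ...     | yes same = inj₁ (trans e (trans (cong (cp i) same) (sym e′)))
  ...     | no n = inj₂ (i , s k i , e , trans e′ (cong (cp i) (¬-not (n ∘ sym))))

  -- Irreducibility puts px₀ on a nonfacial 3-cycle p x₀ m₀ of the original triangulation. Faces k,
  -- j and l on its edges px₀, pm₀ and x₀m₀ choose the copies of its vertices. p has only one copy,
  -- so the cycle can open only at x₀ or m₀.
  third : ∀ {p x} → ¬ Frame p → Edge Tri′ p x →
    ∃ λ m → Edge Tri′ p m × m ≢ x × ¬ Tri′ p x m ×
      (Edge Tri′ x m ⊎ (∃ λ x′ → Twin x x′ × Edge Tri′ m x′) ⊎ (∃ λ m′ → Twin m m′ × Edge Tri′ x m′))
  third {p} {x} ¬f px with interior-adj⁻ ¬f (edge⇒adj TT′ px)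
  ... | p∉w , k , x₀ , kp , kx , p≢x₀ , refl
    with noncontractible⇒cycle TF (p≢x₀ , k , kp , kx) (irreducible p x₀ (p≢x₀ , k , kp , kx))
  ... | m₀ , cycle _ pm xm nonfacial with edge⇒adj TF pm | edge⇒adj TF xm
  ... | p≢m₀ , j , jp , jm | x≢m , l , lx , lm =
    R j m₀ ,
    subst (λ q → Edge Tri′ q (R j m₀)) (R-off p∉w) (adj⇒edge TT′ (adj⁺ jp jm p≢m₀)) ,
    x≢m ∘ R-twin kx jm ∘ sym ,
    nonfacial ∘ interior-tri⁻ ¬f kx jm ,
    alternatives (same-or-twin k l x₀) (same-or-twin j l m₀)
    where
    x′m′ : Adj T′ (R l x₀) (R l m₀)
    x′m′ = adj⁺ lx lm x≢m
    alternatives : R k x₀ ≡ R l x₀ ⊎ Twin (R k x₀) (R l x₀) → R j m₀ ≡ R l m₀ ⊎ Twin (R j m₀) (R l m₀) →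
      Edge Tri′ (R k x₀) (R j m₀) ⊎ (∃ λ x′ → Twin (R k x₀) x′ × Edge Tri′ (R j m₀) x′) ⊎
        (∃ λ m′ → Twin (R j m₀) m′ × Edge Tri′ (R k x₀) m′)
    alternatives (inj₁ ex) (inj₁ em) =
      inj₁ (adj⇒edge TT′ (subst₂ (Adj T′) (sym ex) (sym em) x′m′))
    alternatives (inj₂ tx) (inj₁ em) =
      inj₂ (inj₁ (_ , tx , edge-sym (adj⇒edge TT′ (subst (Adj T′ (R l x₀)) (sym em) x′m′))))
    alternatives (inj₁ ex) (inj₂ tm) =
      inj₂ (inj₂ (_ , tm , adj⇒edge TT′ (subst (λ q → Adj T′ q (R l m₀)) (sym ex) x′m′)))
    -- Both ends changed copies, so x₀m₀ is an edge of w. Since τ commutes with negation, the twin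
    -- edge on the cap closes the cycle again.
    alternatives (inj₂ (i , b , ex , ex′)) (inj₂ (i′ , c , em , em′))
      with copies-adj (subst₂ (Adj T′) ex′ em′ x′m′)
    ... | i≢j , e = inj₁ (adj⇒edge TT′ (subst₂ (Adj T′) (sym ex) (sym em)
          (subst (λ d → Adj T′ (cp i b) (cp i′ d)) (sym c≡) (cap⁺ (cap-edge b i≢j)))))
      where
      c≡ : c ≡ τ i i′ b
      c≡ = Bool.not-injective (trans e (τ-not i i′ b))

  twinned : Twinned Tri′ Frame Twin
  twinned = record
    { twin-sym = λ { (i , b , e , e′) → i , not b , e′ , trans e (cong (cp i) (sym (not-involutive b))) }
    ; twin-frame = λ { (i , b , refl , _) → cp-frame i b }
    ; twin-≢ = λ { (i , b , refl , e) e′ → not-¬ refl (proj₂ (cp-injective {F} fresh (trans e′ e))) }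
    ; twin-no-edge = λ { (i , b , refl , refl) e → proj₁ (copies-adj (edge⇒adj TT′ e)) refl }
    ; third = third }

-- The two-sided and the one-sided cap

module _ {F : Complex} {w u v : Fin 3 → ℕ} {t : ℕ} {s : Sides F} (fresh : Fresh F u v t) where
  open Copies u v

  private
    distinct-copies : ∀ {i j b c} → i ≢ j → cp i b ≢ cp j c
    distinct-copies i≢j = i≢j ∘ proj₁ ∘ cp-injective {F} fresh

  two-sided-shape : TwoSidedNaming F w s → CapShape F w u v t s (capsTwo u v)
  two-sided-shape naming = record
    { τ = λ _ _ b → b
    ; τ-not = λ _ _ _ → refl
    ; naming = λ {i} {j} {k} i≢j hi hj → sym (naming i j k i≢j hi hj)
    ; cap-edge = λ {i} {j} b i≢j → distinct-copies {b = b} i≢j , cap b , cap-∈ i b , cap-∈ j b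
    ; cap-edge⁻ = λ (x≢y , k , hx , hy) → inj₂ (inj₂ (edge x≢y k (copy k hx) (copy k hy)))
    ; cap-vertex = λ (k , hx) → let i , e = copy k hx in inj₂ (i , side k , e) }
    where
    cap : Bool → Fin 2
    cap b = if b then fzero else fsuc fzero
    cap-∈ : ∀ i b → Has (capsTwo u v) (cap b) (cp i b)
    cap-∈ fzero true = inj₁ refl
    cap-∈ (fsuc fzero) true = inj₂ (inj₁ refl)
    cap-∈ (fsuc (fsuc fzero)) true = inj₂ (inj₂ refl)
    cap-∈ fzero false = inj₁ refl
    cap-∈ (fsuc fzero) false = inj₂ (inj₁ refl)
    cap-∈ (fsuc (fsuc fzero)) false = inj₂ (inj₂ refl)
    side : Fin 2 → Bool
    side fzero = true
    side (fsuc fzero) = false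
    copy : ∀ k {x} → Has (capsTwo u v) k x → ∃ λ i → x ≡ cp i (side k)
    copy fzero (inj₁ e) = i0 , e
    copy fzero (inj₂ (inj₁ e)) = i1 , e
    copy fzero (inj₂ (inj₂ e)) = i2 , e
    copy (fsuc fzero) (inj₁ e) = i0 , e
    copy (fsuc fzero) (inj₂ (inj₁ e)) = i1 , e
    copy (fsuc fzero) (inj₂ (inj₂ e)) = i2 , e
    edge : ∀ {x y} → x ≢ y → ∀ k → ∃ (λ i → x ≡ cp i (side k)) → ∃ (λ j → y ≡ cp j (side k)) →
      ∃ λ i → ∃ λ j → ∃ λ b → i ≢ j × x ≡ cp i b × y ≡ cp j b
    edge x≢y k (i , refl) (j , refl) = i , j , side k , (λ { refl → x≢y refl }) , refl , refl

  one-sided-shape : OneSidedNaming F w s → CapShape F w u v t s (capsOne u v t)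
  one-sided-shape (n₀₁ , n₁₂ , n₂₀) = record
    { τ = τ
    ; τ-not = λ i j b → sym (not-distribˡ-xor b (crosses i j))
    ; naming = λ {i} {j} → naming i j
    ; cap-edge = λ {i} {j} → cap-edge i j
    ; cap-edge⁻ = λ (x≢y , k , hx , hy) → cap-edge⁻ x≢y k hx hy
    ; cap-vertex = λ (k , hx) → cap-vertex k hx }
    where
    -- The boundary hexagon changes sides on the copies of w₂w₀ only.
    crosses : Fin 3 → Fin 3 → Bool
    crosses fzero (fsuc (fsuc fzero)) = true
    crosses (fsuc (fsuc fzero)) fzero = true
    crosses _ _ = false
    τ : Fin 3 → Fin 3 → Bool → Bool
    τ i j b = b xor crosses i j
    same : ∀ {a b} → a ≡ b → a ≡ b xor false
    same {b = false} e = e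
    same {b = true} e = e
    opposed : ∀ {a b} → a ≢ b → a ≡ b xor true
    opposed {a} {false} n = ¬-not n
    opposed {a} {true} n = ¬-not n
    naming : ∀ i j {k} → i ≢ j → Has F k (w i) → Has F k (w j) → s k j ≡ τ i j (s k i)
    naming fzero fzero n _ _ = contradiction refl n
    naming fzero (fsuc fzero) n hi hj = same (sym (n₀₁ _ hi hj))
    naming fzero (fsuc (fsuc fzero)) n hi hj = opposed (n₂₀ _ hj hi)
    naming (fsuc fzero) fzero n hi hj = same (n₀₁ _ hj hi)
    naming (fsuc fzero) (fsuc fzero) n _ _ = contradiction refl n
    naming (fsuc fzero) (fsuc (fsuc fzero)) n hi hj = same (sym (n₁₂ _ hi hj))
    naming (fsuc (fsuc fzero)) fzero n hi hj = opposed (n₂₀ _ hi hj ∘ sym)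
    naming (fsuc (fsuc fzero)) (fsuc fzero) n hi hj = same (n₁₂ _ hj hi)
    naming (fsuc (fsuc fzero)) (fsuc (fsuc fzero)) n _ _ = contradiction refl n
    Cap = capsOne u v t
    middle : ∀ {a b c} → b ∈ᶠ (a , b , c)
    middle = inj₂ (inj₁ refl)
    last : ∀ {a b c} → c ∈ᶠ (a , b , c)
    last = inj₂ (inj₂ refl)
    cap-face : ∀ i j b → i ≢ j → ∃ λ k → Has Cap k (cp i b) × Has Cap k (cp j (τ i j b))
    cap-face fzero fzero _ n = contradiction refl n
    cap-face fzero (fsuc fzero) true _ = fzero , middle , last
    cap-face fzero (fsuc fzero) false _ = fsuc (fsuc (fsuc fzero)) , middle , last
    cap-face fzero (fsuc (fsuc fzero)) true _ = fsuc (fsuc (fsuc (fsuc (fsuc fzero)))) , last , middle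
    cap-face fzero (fsuc (fsuc fzero)) false _ = fsuc (fsuc fzero) , last , middle
    cap-face (fsuc fzero) fzero true _ = fzero , last , middle
    cap-face (fsuc fzero) fzero false _ = fsuc (fsuc (fsuc fzero)) , last , middle
    cap-face (fsuc fzero) (fsuc fzero) _ n = contradiction refl n
    cap-face (fsuc fzero) (fsuc (fsuc fzero)) true _ = fsuc fzero , middle , last
    cap-face (fsuc fzero) (fsuc (fsuc fzero)) false _ = fsuc (fsuc (fsuc (fsuc fzero))) , middle , last
    cap-face (fsuc (fsuc fzero)) fzero true _ = fsuc (fsuc fzero) , middle , last
    cap-face (fsuc (fsuc fzero)) fzero false _ = fsuc (fsuc (fsuc (fsuc (fsuc fzero)))) , middle , last
    cap-face (fsuc (fsuc fzero)) (fsuc fzero) true _ = fsuc fzero , last , middle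
    cap-face (fsuc (fsuc fzero)) (fsuc fzero) false _ = fsuc (fsuc (fsuc (fsuc fzero))) , last , middle
    cap-face (fsuc (fsuc fzero)) (fsuc (fsuc fzero)) _ n = contradiction refl n
    cap-edge : ∀ i j b → i ≢ j → Adj Cap (cp i b) (cp j (τ i j b))
    cap-edge i j b n = distinct-copies {b = b} n , cap-face i j b n
    -- The cap face k is t, cp (from k) (side k), cp (to k) (τ (from k) (to k) (side k)).
    from to : Fin 6 → Fin 3
    from fzero = i0
    from (fsuc fzero) = i1
    from (fsuc (fsuc fzero)) = i2
    from (fsuc (fsuc (fsuc fzero))) = i0
    from (fsuc (fsuc (fsuc (fsuc fzero)))) = i1
    from (fsuc (fsuc (fsuc (fsuc (fsuc fzero))))) = i2
    to fzero = i1
    to (fsuc fzero) = i2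
    to (fsuc (fsuc fzero)) = i0
    to (fsuc (fsuc (fsuc fzero))) = i1
    to (fsuc (fsuc (fsuc (fsuc fzero)))) = i2
    to (fsuc (fsuc (fsuc (fsuc (fsuc fzero))))) = i0
    side : Fin 6 → Bool
    side fzero = true
    side (fsuc fzero) = true
    side (fsuc (fsuc fzero)) = true
    side (fsuc (fsuc (fsuc _))) = false
    corners : ∀ k {x} → Has Cap k x → x ∈ᶠ (t , cp (from k) (side k) , cp (to k) (τ (from k) (to k) (side k)))
    corners fzero h = h
    corners (fsuc fzero) h = h
    corners (fsuc (fsuc fzero)) h = h
    corners (fsuc (fsuc (fsuc fzero))) h = h
    corners (fsuc (fsuc (fsuc (fsuc fzero)))) h = h
    corners (fsuc (fsuc (fsuc (fsuc (fsuc fzero))))) h = h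
    from≢to : ∀ k → from k ≢ to k
    from≢to fzero ()
    from≢to (fsuc fzero) ()
    from≢to (fsuc (fsuc fzero)) ()
    from≢to (fsuc (fsuc (fsuc fzero))) ()
    from≢to (fsuc (fsuc (fsuc (fsuc fzero)))) ()
    from≢to (fsuc (fsuc (fsuc (fsuc (fsuc fzero))))) ()
    τ-back : ∀ k → side k ≡ τ (to k) (from k) (τ (from k) (to k) (side k))
    τ-back fzero = refl
    τ-back (fsuc fzero) = refl
    τ-back (fsuc (fsuc fzero)) = refl
    τ-back (fsuc (fsuc (fsuc fzero))) = refl
    τ-back (fsuc (fsuc (fsuc (fsuc fzero)))) = refl
    τ-back (fsuc (fsuc (fsuc (fsuc (fsuc fzero))))) = refl
    cap-edge⁻ : ∀ {x y} → x ≢ y → ∀ k → Has Cap k x → Has Cap k y →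
      x ≡ t ⊎ y ≡ t ⊎ (∃ λ i → ∃ λ j → ∃ λ b → i ≢ j × x ≡ cp i b × y ≡ cp j (τ i j b))
    cap-edge⁻ x≢y k hx hy with corners k hx | corners k hy
    ... | inj₁ e | _ = inj₁ e
    ... | inj₂ _ | inj₁ e = inj₂ (inj₁ e)
    ... | inj₂ (inj₁ e) | inj₂ (inj₁ e′) = contradiction (trans e (sym e′)) x≢y
    ... | inj₂ (inj₂ e) | inj₂ (inj₂ e′) = contradiction (trans e (sym e′)) x≢y
    ... | inj₂ (inj₁ e) | inj₂ (inj₂ e′) = inj₂ (inj₂ (from k , to k , side k , from≢to k , e , e′))
    ... | inj₂ (inj₂ e) | inj₂ (inj₁ e′) = inj₂ (inj₂ (to k , from k , _ , from≢to k ∘ sym , e ,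
          trans e′ (cong (cp (from k)) (τ-back k))))
    cap-vertex : ∀ k {x} → Has Cap k x → x ≡ t ⊎ (∃₂ λ i b → x ≡ cp i b)
    cap-vertex k h with corners k h
    ... | inj₁ e = inj₁ e
    ... | inj₂ (inj₁ e) = inj₂ (_ , _ , e)
    ... | inj₂ (inj₂ e) = inj₂ (_ , _ , e)

-- Short paths

Is : ℕ → ℕ → ℕ → ℕ → Set
Is p q x y = (x ≡ p × y ≡ q) ⊎ (x ≡ q × y ≡ p)

-- xy lies on the path a m n b, whose middle edge may be degenerate.
record Short (Tri : Triangles) (a b x y : ℕ) : Set where
  constructor short
  field
    {m n} : ℕ
    am    : Edge Tri a m
    mn    : m ≡ n ⊎ Edge Tri m n
    nb    : Edge Tri n b
    m≢b   : m ≢ b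
    n≢a   : n ≢ a
    on    : Is a m x y ⊎ Is m n x y ⊎ Is n b x y

is-swap : ∀ {p q x y} → Is p q x y → Is p q y x
is-swap (inj₁ (e , f)) = inj₂ (f , e)
is-swap (inj₂ (e , f)) = inj₁ (f , e)

short-swap : ∀ {Tri a b x y} → Short Tri a b x y → Short Tri a b y x
short-swap (short am mn nb m≢b n≢a on) =
  short am mn nb m≢b n≢a (Sum.map is-swap (Sum.map is-swap is-swap) on)

module ShortPaths {G : Complex} (TG : IsTriangulation G) where
  open Surface (surface TG)

  as-path : ∀ {a b x y} → a ≢ b → x ≢ y → Short (Triangle G) a b x y → EdgeOnShortPath G a b x y
  as-path {a} {b} {x} {y} a≢b x≢y (short {m} {n} am mn nb m≢b n≢a on) = by-cases mn
    where
    by-cases : m ≡ n ⊎ Edge (Triangle G) m n → EdgeOnShortPath G a b x y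
    by-cases (inj₁ refl) = a ∷ m ∷ b ∷ [] ,
      (m ∷ [] , refl , s≤s z≤n , (edge-≢ am ∷ a≢b ∷ []) ∷ (m≢b ∷ []) ∷ [] ∷ [] ,
        edge⇒adj TG am , edge⇒adj TG nb , _) ,
      place on
      where
      place : Is a m x y ⊎ Is m m x y ⊎ Is m b x y →
        ∃₂ λ l r → a ∷ m ∷ b ∷ [] ≡ l ++ x ∷ y ∷ r ⊎ a ∷ m ∷ b ∷ [] ≡ l ++ y ∷ x ∷ r
      place (inj₁ (inj₁ (refl , refl))) = [] , _ , inj₁ refl
      place (inj₁ (inj₂ (refl , refl))) = [] , _ , inj₂ refl
      place (inj₂ (inj₁ (inj₁ (refl , refl)))) = contradiction refl x≢y
      place (inj₂ (inj₁ (inj₂ (refl , refl)))) = contradiction refl x≢y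
      place (inj₂ (inj₂ (inj₁ (refl , refl)))) = a ∷ [] , _ , inj₁ refl
      place (inj₂ (inj₂ (inj₂ (refl , refl)))) = a ∷ [] , _ , inj₂ refl
    by-cases (inj₂ mn) = a ∷ m ∷ n ∷ b ∷ [] ,
      (m ∷ n ∷ [] , refl , s≤s (s≤s z≤n) ,
        (edge-≢ am ∷ n≢a ∘ sym ∷ a≢b ∷ []) ∷ (edge-≢ mn ∷ m≢b ∷ []) ∷ (edge-≢ nb ∷ []) ∷ [] ∷ [] ,
        edge⇒adj TG am , edge⇒adj TG mn , edge⇒adj TG nb , _) ,
      place on
      where
      place : Is a m x y ⊎ Is m n x y ⊎ Is n b x y →
        ∃₂ λ l r → a ∷ m ∷ n ∷ b ∷ [] ≡ l ++ x ∷ y ∷ r ⊎ a ∷ m ∷ n ∷ b ∷ [] ≡ l ++ y ∷ x ∷ r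
      place (inj₁ (inj₁ (refl , refl))) = [] , _ , inj₁ refl
      place (inj₁ (inj₂ (refl , refl))) = [] , _ , inj₂ refl
      place (inj₂ (inj₁ (inj₁ (refl , refl)))) = a ∷ [] , _ , inj₁ refl
      place (inj₂ (inj₁ (inj₂ (refl , refl)))) = a ∷ [] , _ , inj₂ refl
      place (inj₂ (inj₂ (inj₁ (refl , refl)))) = a ∷ m ∷ [] , _ , inj₁ refl
      place (inj₂ (inj₂ (inj₂ (refl , refl)))) = a ∷ m ∷ [] , _ , inj₂ refl

  -- The edge of a short path recorded at x may be its degenerate middle edge.
  proper-edge : ∀ {a b x y} → Short (Triangle G) a b x y → ∃ λ z → x ≢ z × Short (Triangle G) a b x z
  proper-edge (short am mn nb m≢b n≢a (inj₁ (inj₁ (refl , _)))) =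
    _ , edge-≢ am , short am mn nb m≢b n≢a (inj₁ (inj₁ (refl , refl)))
  proper-edge (short am mn nb m≢b n≢a (inj₁ (inj₂ (refl , _)))) =
    _ , edge-≢ am ∘ sym , short am mn nb m≢b n≢a (inj₁ (inj₂ (refl , refl)))
  proper-edge (short am mn nb m≢b n≢a (inj₂ (inj₁ (inj₁ (refl , _))))) =
    _ , edge-≢ am ∘ sym , short am mn nb m≢b n≢a (inj₁ (inj₂ (refl , refl)))
  proper-edge (short am mn nb m≢b n≢a (inj₂ (inj₁ (inj₂ (refl , _))))) =
    _ , edge-≢ nb , short am mn nb m≢b n≢a (inj₂ (inj₂ (inj₁ (refl , refl))))
  proper-edge (short am mn nb m≢b n≢a (inj₂ (inj₂ (inj₁ (refl , _))))) =
    _ , edge-≢ nb , short am mn nb m≢b n≢a (inj₂ (inj₂ (inj₁ (refl , refl))))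
  proper-edge (short am mn nb m≢b n≢a (inj₂ (inj₂ (inj₂ (refl , _))))) =
    _ , edge-≢ nb ∘ sym , short am mn nb m≢b n≢a (inj₂ (inj₂ (inj₂ (refl , refl))))

edge⇒vertex : ∀ {G a b x y} → EdgeOnShortPath G a b x y → VertexOnShortPath G a b x
edge⇒vertex (p , path , l , r , inj₁ refl) = p , path , ∈-++⁺ʳ l (here refl)
edge⇒vertex (p , path , l , r , inj₂ refl) = p , path , ∈-++⁺ʳ l (there (here refl))

-- An invariant: its validity after the cut and its survival under contraction

VertexAlternatives : Triangles → Complex → (u v : Fin 3 → ℕ) → ℕ → Set
VertexAlternatives Tri Fr u v x =
  (∃₂ λ y z → Essential Tri (FrameVertex Fr) x y z) ⊎
  (∃₂ λ i j → i < j × ∃ (Short Tri (u i) (v i) x) × ∃ (Short Tri (u j) (v j) x))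

-- The conclusion with noncontractible edges replaced by essential 3-cycles: lying on a nonfacial
-- 3-cycle can be lost in a later contraction, lying on an essential one cannot.
record Invariant (Tri : Triangles) (Fr : Complex) (u v : Fin 3 → ℕ) : Set where
  field
    edges    : ∀ {x y} → Edge Tri x y → FrameEdge Fr x y ⊎
      (∃ λ i → Short Tri (u i) (v i) x y) ⊎ ∃ (Essential Tri (FrameVertex Fr) x y)
    vertices : ∀ {x y} → Edge Tri x y → FrameVertex Fr x ⊎ VertexAlternatives Tri Fr u v x

module _ {F : Complex} {w u v : Fin 3 → ℕ} {t : ℕ} {s : Sides F} {Fr T′ : Complex}
  (TF : IsTriangulation F) (irreducible : Irreducible F)
  (w-injective : ∀ i j → w i ≡ w j → i ≡ j)
  (fresh : Fresh F u v t) (local : LocalSides F w s) (shape : CapShape F w u v t s Fr)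
  (cut-cap : IsCutCap F w u v s Fr T′) (TT′ : IsTriangulation T′) where

  open Copies u v
  open CutCapped TF irreducible w-injective fresh local shape cut-cap TT′
  open Surface (surface TT′)
  open Separation (surface TT′)

  private
    Alternatives : ℕ → ℕ → Set
    Alternatives x y = (∃ λ i → Short Tri′ (u i) (v i) x y) ⊎ ∃ (Essential Tri′ Frame x y)

    essential : ∀ {x y z} → Cycle Tri′ x y z → Essential Tri′ Frame x y z
    essential C = C , no-disc (surface TT′) twinned C

    off-frame-≢ : ∀ {p i b} → ¬ Frame p → p ≢ cp i b
    off-frame-≢ {i = i} {b} ¬f refl = ¬f (cp-frame i b)

    -- A cycle opened at x becomes the path x, p, m, x′, and one opened at m the path m, p, x, m′.
    -- The Boolean of the twin decides which end is the copy u i.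
    interior-edge : ∀ {p x} → ¬ Frame p → Edge Tri′ p x → Alternatives p x
    interior-edge {p} {x} ¬f px with third ¬f px
    ... | m , pm , m≢x , nonfacial , inj₁ xm = inj₂ (m , essential (cycle px pm xm nonfacial))
    ... | m , pm , m≢x , _ , inj₂ (inj₁ (x′ , (i , true , refl , refl) , mx′)) =
          inj₁ (i , short (edge-sym px) (inj₂ pm) mx′ (off-frame-≢ {b = false} ¬f) m≢x (inj₁ (inj₂ (refl , refl))))
    ... | m , pm , m≢x , _ , inj₂ (inj₁ (x′ , (i , false , refl , refl) , mx′)) =
          inj₁ (i , short (edge-sym mx′) (inj₂ (edge-sym pm)) px m≢x (off-frame-≢ {b = true} ¬f)
            (inj₂ (inj₂ (inj₁ (refl , refl)))))
    ... | m , pm , m≢x , _ , inj₂ (inj₂ (m′ , (i , true , refl , refl) , xm′)) =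
          inj₁ (i , short (edge-sym pm) (inj₂ px) xm′ (off-frame-≢ {b = false} ¬f) (m≢x ∘ sym)
            (inj₂ (inj₁ (inj₁ (refl , refl)))))
    ... | m , pm , m≢x , _ , inj₂ (inj₂ (m′ , (i , false , refl , refl) , xm′)) =
          inj₁ (i , short (edge-sym xm′) (inj₂ (edge-sym px)) pm (m≢x ∘ sym) (off-frame-≢ {b = true} ¬f)
            (inj₂ (inj₁ (inj₂ (refl , refl)))))

    alternatives-swap : ∀ {x y} → Alternatives x y → Alternatives y x
    alternatives-swap = Sum.map (λ (i , h) → i , short-swap h) λ (z , C , _) → z , essential (cycle-swap₁₂ C)

    one-copy : ∀ {p i} → ¬ Frame p → Edge Tri′ p (u i) → ¬ Edge Tri′ p (v i)
    one-copy ¬f e e′ = no-common-interior {b = true} ¬f (edge⇒adj TT′ e) (edge⇒adj TT′ e′)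

    one-copy-neighbour : ∀ {p n i} → ¬ Frame p → Edge Tri′ p n → Edge Tri′ n (u i) → ¬ Edge Tri′ n (v i)
    one-copy-neighbour ¬f pn e e′ =
      no-common-neighbour {b = true} ¬f (edge⇒adj TT′ pn) (edge⇒adj TT′ e) (edge⇒adj TT′ e′)

    touches-copy : ∀ {p y i} → ¬ Frame p → Short Tri′ (u i) (v i) p y → ∃ λ b → Edge Tri′ p (cp i b)
    touches-copy {i = i} ¬f (short am mn nb _ _ (inj₁ (inj₁ (refl , _)))) = contradiction (cp-frame i true) ¬f
    touches-copy ¬f (short am mn nb _ _ (inj₁ (inj₂ (refl , _)))) = true , edge-sym am
    touches-copy ¬f (short am mn nb _ _ (inj₂ (inj₁ (inj₁ (refl , _))))) = true , edge-sym am
    touches-copy ¬f (short am mn nb _ _ (inj₂ (inj₁ (inj₂ (refl , _))))) = false , nb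
    touches-copy ¬f (short am mn nb _ _ (inj₂ (inj₂ (inj₁ (refl , _))))) = false , nb
    touches-copy {i = i} ¬f (short am mn nb _ _ (inj₂ (inj₂ (inj₂ (refl , _))))) =
      contradiction (cp-frame i false) ¬f

    -- An edge pn in a face with a copy of w i leads to the other copy only via a second
    -- common neighbour, which does not exist.
    not-short-beside : ∀ {p n i} b → ¬ Frame p → Tri′ p (cp i b) n → ¬ Short Tri′ (u i) (v i) p n
    not-short-beside {p} {n} {i} b ¬f face (short am mn nb _ _ on) = go b face on
      where
      go : ∀ b → Tri′ p (cp i b) n → _ → ⊥
      go b f (inj₁ (inj₁ (refl , _))) = ¬f (cp-frame i true)
      go true f (inj₁ (inj₂ (_ , refl))) = distinct₂₃ f refl
      go false f (inj₁ (inj₂ (refl , refl))) = one-copy ¬f (edge-sym am) (_ , f)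
      go b f (inj₂ (inj₂ (inj₂ (refl , _)))) = ¬f (cp-frame i false)
      go true f (inj₂ (inj₂ (inj₁ (refl , refl)))) = one-copy ¬f (_ , f) nb
      go false f (inj₂ (inj₂ (inj₁ (_ , refl)))) = distinct₂₃ f refl
      go true f (inj₂ (inj₁ (inj₁ (refl , refl)))) = one-copy-neighbour ¬f (edge₁₃ f) (edge-sym (edge₂₃ f)) nb
      go false f (inj₂ (inj₁ (inj₁ (refl , refl)))) = one-copy ¬f (edge-sym am) (_ , f)
      go true f (inj₂ (inj₁ (inj₂ (refl , refl)))) = one-copy ¬f (_ , f) nb
      go false f (inj₂ (inj₁ (inj₂ (refl , refl)))) =
        one-copy-neighbour ¬f (edge₁₃ f) (edge-sym am) (edge-sym (edge₂₃ f))

    interior-vertex : ∀ {p y} → ¬ Frame p → Edge Tri′ p y → VertexAlternatives Tri′ Fr u v p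
    interior-vertex ¬f py with interior-edge ¬f py
    ... | inj₂ (z , h) = inj₁ (_ , z , h)
    ... | inj₁ (i , h) with touches-copy ¬f h
    ...   | b , (n , face) with interior-edge ¬f (edge₁₃ face)
    ...     | inj₂ (z , h′) = inj₁ (_ , z , h′)
    ...     | inj₁ (j , h′) with Fin.<-cmp i j
    ...       | tri< i<j _ _ = inj₂ (i , j , i<j , (_ , h) , (_ , h′))
    ...       | tri> _ _ j<i = inj₂ (j , i , j<i , (_ , h′) , (_ , h))
    ...       | tri≈ _ refl _ = contradiction h′ (not-short-beside b ¬f face)

  frame? : ∀ x → Dec (Frame x)
  frame? x = Fin.any? (λ k → x ∈ᶠ? lookup Fr k)

  cut-invariant : Invariant Tri′ Fr u v
  cut-invariant = record { edges = edges ; vertices = vertices }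
    where
    edges : ∀ {x y} → Edge Tri′ x y → FrameEdge Fr x y ⊎ Alternatives x y
    edges xy with frame-edge⊎interior (edge⇒adj TT′ xy)
    ... | inj₁ h = inj₁ h
    ... | inj₂ (inj₁ ¬f) = inj₂ (interior-edge ¬f xy)
    ... | inj₂ (inj₂ ¬f) = inj₂ (alternatives-swap (interior-edge ¬f (edge-sym xy)))
    vertices : ∀ {x y} → Edge Tri′ x y → Frame x ⊎ VertexAlternatives Tri′ Fr u v x
    vertices {x} xy with frame? x
    ... | yes f = inj₁ f
    ... | no ¬f = inj₂ (interior-vertex ¬f xy)

module _ {F Fr : Complex} {u v : Fin 3 → ℕ} {a c : ℕ} (TF : IsTriangulation F)
  (TG : IsTriangulation (contract F a c)) (ac : Adj F a c) (h : Contractible F a c)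
  (¬a : ¬ FrameVertex Fr a) (¬c : ¬ FrameVertex Fr c)
  (u-frame : ∀ i → FrameVertex Fr (u i)) (v-frame : ∀ i → FrameVertex Fr (v i)) where

  private
    φ = renamed a c
    m = contraction-merges TF ac h
    G = contract F a c
  open Surface (surface TF)
  open Contraction (surface TF) (surface TG) {φ}

  private
    fixed : ∀ {x} → FrameVertex Fr x → φ x ≡ x
    fixed f = renamed-off λ { refl → ¬c f }

    φ-frame : ∀ {x y} → FrameVertex Fr y → φ x ≡ y → x ≡ y
    φ-frame f e = sym (unmerged m (λ { refl → ¬a f }) (λ { refl → ¬c f }) (trans (fixed f) (sym e)))

    -- The ends are frame vertices, so they are fixed and nothing merges into them. Only the two
    -- inner vertices can merge, and then the middle edge degenerates.
    push-short : ∀ {p q x y} → FrameVertex Fr p → FrameVertex Fr q →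
      Short (Triangle F) p q x y → Short (Triangle G) p q (φ x) (φ y)
    push-short {p} {q} {x} {y} fp fq (short {k} {l} pk kl lq k≢q l≢p on) = short
      (subst (λ z → Edge (Triangle G) z (φ k)) (fixed fp)
        (φ-edge m pk λ e → edge-≢ pk (sym (φ-frame fp (trans (sym e) (fixed fp))))))
      (middle kl)
      (subst (Edge (Triangle G) (φ l)) (fixed fq) (φ-edge m lq λ e → edge-≢ lq (φ-frame fq (trans e (fixed fq)))))
      (k≢q ∘ φ-frame fq) (l≢p ∘ φ-frame fp)
      (Sum.map (image (fixed fp) refl) (Sum.map (image refl refl) (image refl (fixed fq))) on)
      where
      middle : k ≡ l ⊎ Edge (Triangle F) k l → φ k ≡ φ l ⊎ Edge (Triangle G) (φ k) (φ l)
      middle (inj₁ e) = inj₁ (cong φ e)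
      middle (inj₂ e) with φ k ≟ φ l
      ... | yes e′ = inj₁ e′
      ... | no n = inj₂ (φ-edge m e n)
      image : ∀ {r s r′ s′} → φ r ≡ r′ → φ s ≡ s′ → Is r s x y → Is r′ s′ (φ x) (φ y)
      image er es (inj₁ (refl , refl)) = inj₁ (er , es)
      image er es (inj₂ (refl , refl)) = inj₂ (es , er)

    push-essential : ∀ {x y z} → Essential (Triangle F) (FrameVertex Fr) x y z →
      Essential (Triangle G) (FrameVertex Fr) (φ x) (φ y) (φ z)
    push-essential = essential-push m ¬a ¬c fixed

  contract-invariant : Invariant (Triangle F) Fr u v → Invariant (Triangle G) Fr u v
  contract-invariant inv = record { edges = edges ; vertices = vertices }
    where
    module I = Invariant inv
    edges : ∀ {x y} → Edge (Triangle G) x y → FrameEdge Fr x y ⊎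
      (∃ λ i → Short (Triangle G) (u i) (v i) x y) ⊎ ∃ (Essential (Triangle G) (FrameVertex Fr) x y)
    edges xy with lift-adj {F} {a} {c} (edge⇒adj TG xy)
    ... | x , y , x~y , refl , refl with I.edges (adj⇒edge TF x~y)
    ... | inj₁ f@(_ , k , fx , fy) = inj₁ (subst₂ (Adj Fr) (sym (fixed (k , fx))) (sym (fixed (k , fy))) f)
    ... | inj₂ (inj₁ (i , s)) = inj₂ (inj₁ (i , push-short (u-frame i) (v-frame i) s))
    ... | inj₂ (inj₂ (z , e)) = inj₂ (inj₂ (φ z , push-essential e))
    vertices : ∀ {x y} → Edge (Triangle G) x y → FrameVertex Fr x ⊎ VertexAlternatives (Triangle G) Fr u v x
    vertices xy with lift-adj {F} {a} {c} (edge⇒adj TG xy)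
    ... | x , y , x~y , refl , refl with I.vertices (adj⇒edge TF x~y)
    ... | inj₁ f = inj₁ (subst (FrameVertex Fr) (sym (fixed f)) f)
    ... | inj₂ (inj₁ (y′ , z , e)) = inj₂ (inj₁ (φ y′ , φ z , push-essential e))
    ... | inj₂ (inj₂ (i , j , i<j , (y₁ , s₁) , (y₂ , s₂))) =
          inj₂ (inj₂ (i , j , i<j , (φ y₁ , push-short (u-frame i) (v-frame i) s₁)
                                  , (φ y₂ , push-short (u-frame j) (v-frame j) s₂)))

-- From the invariant to the statement

first-triangulation : ∀ {Fr F G} → Contracts Fr F G → IsTriangulation G → IsTriangulation F
first-triangulation done TG = TG
first-triangulation (step TF _ _ _ _ _) _ = TF

-- Every contraction step records that its source is a triangulation; with the final complex given
-- as one, both sides of each step are surfaces.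
contracts-invariant : ∀ {Fr F G u v} →
  (∀ i → FrameVertex Fr (u i)) → (∀ i → FrameVertex Fr (v i)) →
  Contracts Fr F G → IsTriangulation G → Invariant (Triangle F) Fr u v → Invariant (Triangle G) Fr u v
contracts-invariant fu fv done TG inv = inv
contracts-invariant fu fv (step TF ac ¬a ¬c h rest) TG inv =
  contracts-invariant fu fv rest TG
    (contract-invariant TF (first-triangulation rest TG) ac h ¬a ¬c fu fv inv)

another-corner : ∀ f {x} → Proper f → x ∈ᶠ f → ∃ λ y → y ∈ᶠ f × x ≢ y
another-corner _ (a≢b , _ , _) (inj₁ refl) = _ , inj₂ (inj₁ refl) , a≢b
another-corner _ (a≢b , _ , _) (inj₂ (inj₁ refl)) = _ , inj₁ refl , a≢b ∘ sym
another-corner _ (_ , _ , a≢c) (inj₂ (inj₂ refl)) = _ , inj₁ refl , a≢c ∘ sym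

conclude : ∀ {Fr G u v} → IsTriangulation G → (∀ i → u i ≢ v i) → Invariant (Triangle G) Fr u v →
  (∀ x y → Adj G x y →
    FrameEdge Fr x y ⊎ ¬ Contractible G x y ⊎ ∃ (λ i → EdgeOnShortPath G (u i) (v i) x y))
  × (∀ x → VertexOf G x →
    FrameVertex Fr x ⊎ ∃ (λ y → Adj G x y × ¬ Contractible G x y) ⊎
    ∃₂ (λ i j → i < j × VertexOnShortPath G (u i) (v i) x × VertexOnShortPath G (u j) (v j) x))
conclude {Fr} {G} {u} {v} TG u≢v inv = edge-case , vertex-case
  where
  module I = Invariant inv
  open ShortPaths TG
  edge-case : ∀ x y → Adj G x y →
    FrameEdge Fr x y ⊎ ¬ Contractible G x y ⊎ ∃ (λ i → EdgeOnShortPath G (u i) (v i) x y)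
  edge-case x y xy with I.edges (adj⇒edge TG xy)
  ... | inj₁ f = inj₁ f
  ... | inj₂ (inj₁ (i , s)) = inj₂ (inj₂ (i , as-path (u≢v i) (proj₁ xy) s))
  ... | inj₂ (inj₂ (z , C , _)) = inj₂ (inj₁ (cycle⇒¬contractible TG C))
  on-path : ∀ {i x} → ∃ (Short (Triangle G) (u i) (v i) x) → VertexOnShortPath G (u i) (v i) x
  on-path {i} (_ , s) with proper-edge s
  ... | _ , x≢z , s′ = edge⇒vertex (as-path (u≢v i) x≢z s′)
  vertex-edge : ∀ {x} → VertexOf G x → ∃ (Edge (Triangle G) x)
  vertex-edge (k , hx) with another-corner (lookup G k) (IsTriangulation.faceDistinct TG k) hx
  ... | y , hy , x≢y = y , adj⇒edge TG (x≢y , k , hx , hy)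
  vertex-case : ∀ x → VertexOf G x →
    FrameVertex Fr x ⊎ ∃ (λ y → Adj G x y × ¬ Contractible G x y) ⊎
    ∃₂ (λ i j → i < j × VertexOnShortPath G (u i) (v i) x × VertexOnShortPath G (u j) (v j) x)
  vertex-case x hx with I.vertices (proj₂ (vertex-edge hx))
  ... | inj₁ f = inj₁ f
  ... | inj₂ (inj₁ (y , z , C , _)) = inj₂ (inj₁ (y , edge⇒adj TG (Cycle.edge₁₂ C) , cycle⇒¬contractible TG C))
  ... | inj₂ (inj₂ (i , j , i<j , sᵢ , sⱼ)) = inj₂ (inj₂ (i , j , i<j , on-path sᵢ , on-path sⱼ))

cut-cap-invariant : ∀ {T w u v t T′ Fr} →
  IsTriangulation T → Irreducible T → (∀ i j → w i ≡ w j → i ≡ j) → Fresh T u v t →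
  CutCap T w u v t T′ Fr → IsTriangulation T′ →
  Invariant (Triangle T′) Fr u v × (∀ i → FrameVertex Fr (u i)) × (∀ i → FrameVertex Fr (v i))
cut-cap-invariant {T} {w} {u} {v} {t} TT irr w-inj fresh (twoSided s local naming) TT′ =
  cut-invariant {T} {w} {u} {v} {t} {s} TT irr w-inj fresh local shape cut-cap TT′ ,
  (λ i → cp-frame i true) , (λ i → cp-frame i false)
  where
  cut-cap = isCutCap {T} {w} w-inj u v s (capsTwo u v)
  shape = two-sided-shape {T} {w} {u} {v} {t} {s} fresh naming
  open CutCapped {T} {w} {u} {v} {t} {s} TT irr w-inj fresh local shape cut-cap TT′
cut-cap-invariant {T} {w} {u} {v} {t} TT irr w-inj fresh (oneSided s local naming) TT′ =
  cut-invariant {T} {w} {u} {v} {t} {s} TT irr w-inj fresh local shape cut-cap TT′ ,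
  (λ i → cp-frame i true) , (λ i → cp-frame i false)
  where
  cut-cap = isCutCap {T} {w} w-inj u v s (capsOne u v t)
  shape = one-sided-shape {T} {w} {u} {v} {t} {s} fresh naming
  open CutCapped {T} {w} {u} {v} {t} {s} TT irr w-inj fresh local shape cut-cap TT′

theorem4p2 : (T : Complex) (w u v : Fin 3 → ℕ) (t : ℕ) (T' Fr T'' : Complex) →
    IsTriangulation T → ¬ IsSphere T → Irreducible T →
    ThreeCycle T w → Nonseparating T w →
    Fresh T u v t → CutCap T w u v t T' Fr →
    Contracts Fr T' T'' → IsTriangulation T'' →
    (∀ x y → Adj T'' x y →
    FrameEdge Fr x y ⊎ ¬ Contractible T'' x y ⊎
    ∃ (λ i → EdgeOnShortPath T'' (u i) (v i) x y))
    × (∀ x → VertexOf T'' x →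
    FrameVertex Fr x ⊎ ∃ (λ y → Adj T'' x y × ¬ Contractible T'' x y) ⊎
    ∃₂ (λ i j → i < j × VertexOnShortPath T'' (u i) (v i) x
    × VertexOnShortPath T'' (u j) (v j) x))
theorem4p2 T w u v t T' Fr T'' TT _ irr (w-inj , _) _ fresh cut contracts TT'' =
  let inv , fu , fv = cut-cap-invariant TT irr w-inj fresh cut (first-triangulation contracts TT'')
  in conclude TT'' u≢v (contracts-invariant fu fv contracts TT'' inv)
  where
  u≢v : ∀ i → u i ≢ v i
  u≢v i e with proj₂ (Copies.cp-injective u v {T} fresh {i} {i} {true} {false} e)
  ... | ()
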